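{- For all integers $n\ge 0$ and $\alpha\ge 0$, \[\overline{p}\big(4^{\alpha}(40n+35)\big)\equiv 0 \pmod{40}.\] In particular (case $\alpha=0$), $\overline{p}(40n+35)\equiv 0 \pmod{40}$ for all $n\ge 0$.
   Context: An overpartition of a nonnegative integer $n$ is a partition of $n$ in which the first occurrence of each distinct part may (or may not) be overlined; $\overline{p}(n)$ denotes the number of overpartitions of $n$ (with $\overline{p}(0)=1$). Equivalently, $\sum_{n\ge0}\overline{p}(n)q^n=\prod_{k\ge1}\frac{1+q^k}{1-q^k}$. -}

module Defs where

open import Data.Bool using (Bool; true; false)
import Data.Bool.Properties as Bool
open import Data.List using (List; []; _∷_; length; map; filter; upTo; cartesianProduct; cartesianProductWith)
open import Data.List.Membership.Propositional using (_∈_)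
open import Data.List.Membership.Propositional.Properties using (∈-map⁺; ∈-upTo⁺; ∈-cartesianProduct⁺; ∈-cartesianProductWith⁺; ∈-cartesianProductWith⁻; ∈-filter⁺; ∈-filter⁻)
open import Data.List.Properties using (∷-injective)
open import Data.List.Relation.Unary.All as All using (All; []; _∷_)
open import Data.List.Relation.Unary.AllPairs using ([]; _∷_)
open import Data.List.Relation.Unary.Any using (here; there)
open import Data.List.Relation.Unary.Linked using (Linked; linked?)
open import Data.List.Relation.Unary.Unique.Propositional using (Unique)
import Data.List.Relation.Unary.Unique.Propositional.Properties as Unique
open import Data.Nat using (ℕ; zero; suc; _≤_; _<_; _>_; z≤n; s≤s; _≟_; _<?_; _>?_)
open import Data.Nat.ListAction using (sum)
open import Data.Nat.Properties using (suc-injective; ≤-trans; ≤-reflexive; m≤m+n; m≤n+m; +-mono-≤)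
open import Data.Product using (_×_; _,_; proj₁; proj₂)
open import Data.Sum using (_⊎_)
open import Function using (_∘_; _⇔_; mk⇔)
open import Relation.Binary.PropositionalEquality using (_≡_; _≢_; refl)
open import Relation.Nullary using (Dec)
open import Relation.Nullary.Decidable using (map′; _×-dec_; _⊎-dec_)

-- The Boolean is true when the part is overlined.
Part : Set
Part = ℕ × Bool

-- What consecutive parts must satisfy: the sizes are non-increasing, and a
-- part equal to its predecessor is not a first occurrence, hence not overlined.
_≽_ : Part → Part → Set
(a , _) ≽ (b , t) = a > b ⊎ (a ≡ b × t ≡ false)

record IsOverpartition (n : ℕ) (ps : List Part) : Set where
  constructor isOverpartition
  field
    positive : All (λ p → 0 < proj₁ p) ps
    ordered  : Linked _≽_ ps
    size     : sum (map proj₁ ps) ≡ n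

_≽?_ : ∀ p q → Dec (p ≽ q)
(a , _) ≽? (b , t) = (a >? b) ⊎-dec ((a ≟ b) ×-dec (t Bool.≟ false))

isOverpartition? : ∀ n ps → Dec (IsOverpartition n ps)
isOverpartition? n ps =
  map′ (λ (p , o , s) → isOverpartition p o s)
       (λ (isOverpartition p o s) → p , o , s)
       (All.all? (λ p → 0 <? proj₁ p) ps
         ×-dec linked? _≽?_ ps
         ×-dec (sum (map proj₁ ps) ≟ n))

-- All lists of length at most m with entries from as.
words : {A : Set} → ℕ → List A → List (List A)
words zero    as = [] ∷ []
words (suc m) as = [] ∷ cartesianProductWith _∷_ as (words m as)

partsUpTo : ℕ → List Part
partsUpTo n = cartesianProduct (map suc (upTo n)) (true ∷ false ∷ [])

-- An overpartition of n has at most n parts, each of size at most n, so no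
-- overpartition is missed; see ∈-overpartitions and overpartitions-unique.
overpartitions : ℕ → List (List Part)
overpartitions n = filter (isOverpartition? n) (words n (partsUpTo n))

p̄ : ℕ → ℕ
p̄ n = length (overpartitions n)

private
  words-complete : {A : Set} {as xs : List A} (m : ℕ) →
                   All (_∈ as) xs → length xs ≤ m → xs ∈ words m as
  words-complete zero    []       _         = here refl
  words-complete (suc m) []       _         = here refl
  words-complete (suc m) (p ∷ ps) (s≤s len) =
    there (∈-cartesianProductWith⁺ _∷_ p (words-complete m ps len))

  words-unique : {A : Set} {as : List A} (m : ℕ) → Unique as → Unique (words m as)
  words-unique zero _ = [] ∷ []
  words-unique {as = as} (suc m) u =
    All.tabulate []≢
    ∷ Unique.cartesianProductWith⁺ _∷_ ∷-injective u (words-unique m u)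
    where
    []≢ : ∀ {ys} → ys ∈ cartesianProductWith _∷_ as (words m as) → [] ≢ ys
    []≢ ys∈ refl with ∈-cartesianProductWith⁻ _∷_ as (words m as) ys∈
    ... | _ , _ , _ , _ , ()

  partsUpTo-unique : ∀ n → Unique (partsUpTo n)
  partsUpTo-unique n =
    Unique.cartesianProduct⁺ (Unique.map⁺ suc-injective (Unique.upTo⁺ n))
                             (((λ ()) ∷ []) ∷ [] ∷ [])

  ∈-bools : ∀ b → b ∈ true ∷ false ∷ []
  ∈-bools true  = here refl
  ∈-bools false = there (here refl)

  ∈-partsUpTo : ∀ {n} ps → All (λ p → 0 < proj₁ p) ps →
                sum (map proj₁ ps) ≤ n → All (_∈ partsUpTo n) ps
  ∈-partsUpTo []                 []       _ = []
  ∈-partsUpTo ((suc a , b) ∷ ps) (_ ∷ +s) s =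
    ∈-cartesianProduct⁺ (∈-map⁺ suc (∈-upTo⁺ (≤-trans (m≤m+n (suc a) _) s))) (∈-bools b)
    ∷ ∈-partsUpTo ps +s (≤-trans (m≤n+m _ (suc a)) s)

  length≤sum : ∀ {ps : List Part} → All (λ p → 0 < proj₁ p) ps →
               length ps ≤ sum (map proj₁ ps)
  length≤sum []       = z≤n
  length≤sum (p ∷ ps) = +-mono-≤ p (length≤sum ps)

∈-overpartitions : ∀ n ps → ps ∈ overpartitions n ⇔ IsOverpartition n ps
∈-overpartitions n ps = mk⇔ (proj₂ ∘ ∈-filter⁻ (isOverpartition? n) {xs = words n (partsUpTo n)}) complete
  where
  complete : IsOverpartition n ps → ps ∈ overpartitions n
  complete o@(isOverpartition pos _ s) =
    ∈-filter⁺ (isOverpartition? n)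
      (words-complete n (∈-partsUpTo ps pos (≤-reflexive s))
                        (≤-trans (length≤sum pos) (≤-reflexive s)))
      o

overpartitions-unique : ∀ n → Unique (overpartitions n)
overpartitions-unique n =
  Unique.filter⁺ (isOverpartition? n) (words-unique n (partsUpTo-unique n))

{-# OPTIONS --safe #-}
module Submission where

-- Let A(q) = Σ p̄(n) (−q)ⁿ and φ(q) = Σ q^(j²), the sum over all integers j.
-- Gauss's identity A φ = 1 is the limit of a finite identity for the generating
-- functions F s of the overpartitions with parts at most s, which follows from
-- F (s + 1) − F s = q^(s+1) (F (s + 1) + F s) by summation by parts.
--
-- Modulo 8: φ − 1 has even coefficients, so A = 1 − (φ − 1) + (φ − 1)²,
-- whose coefficients vanish at the numbers that are not sums of two squares,
-- in particular at 4^α (8 m + 3).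
--
-- Modulo 5: φ⁵ = φ(q⁵), so A φ(q⁵) = φ⁴.  The number r₄ of representations as
-- a sum of four squares satisfies r₄(5 n) = r₄(n) modulo 5: there are six
-- quaternion ideals of norm 5, each of them contains r₄(n) elements of norm 5 n,
-- and an element of norm 5 n lies in exactly one of them, or in all six if it is
-- a multiple of 5.  Hence extracting the coefficients at multiples of 5 gives
-- Σ (−1)ⁿ p̄(5 n) qⁿ = φ⁴ / φ = φ³, whose coefficients vanish at the numbers
-- 4^α (8 k + 7), which are not sums of three squares.

open import Algebra.Bundles using (CommutativeRing)
import Algebra.Construct.Pointwise as Pointwise
import Algebra.Solver.Ring.NaturalCoefficients.Default as SemiringSolver
open import Data.Nat as ℕ using (ℕ; zero; suc; _≤_; _<_; z≤n; s≤s)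
import Data.Nat.Properties as ℕ
open import Data.Nat.Solver using () renaming (module +-*-Solver to ℕ-Solver)
open import Data.Product using (_×_; _,_; proj₁; proj₂; ∃; ∃₂)
open import Function using (_∘_; id; mk⇔; Equivalence)
open import Level using (Level; 0ℓ)
import Relation.Binary.PropositionalEquality as ≡

-- Power series over a commutative ring

module PowerSeries {c ℓ : Level} (R : CommutativeRing c ℓ) where

  open CommutativeRing R
  open import Algebra.Properties.CommutativeSemigroup +-commutativeSemigroup using (interchange)
  open import Relation.Binary.Reasoning.Setoid setoid

  -- The Cauchy product, with the first factor shifted in the recursion, so that inductions
  -- generalise over that factor.
  conv : (ℕ → Carrier) → (ℕ → Carrier) → ℕ → Carrier
  conv f g zero    = f 0 * g 0
  conv f g (suc n) = f 0 * g (suc n) + conv (f ∘ suc) g n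

  one : ℕ → Carrier
  one zero    = 1#
  one (suc _) = 0#

  X : ℕ → Carrier
  X zero    = 0#
  X (suc n) = one n

  private
    infix 4 _≋_
    _≋_ : (ℕ → Carrier) → (ℕ → Carrier) → Set ℓ
    f ≋ g = ∀ n → f n ≈ g n

  conv-cong-≤ : ∀ {f f′ g g′} n → (∀ i → i ≤ n → f i ≈ f′ i) → (∀ i → i ≤ n → g i ≈ g′ i) →
                conv f g n ≈ conv f′ g′ n
  conv-cong-≤ zero    f≈ g≈ = *-cong (f≈ 0 z≤n) (g≈ 0 z≤n)
  conv-cong-≤ (suc n) f≈ g≈ =
    +-cong (*-cong (f≈ 0 z≤n) (g≈ (suc n) ℕ.≤-refl))
           (conv-cong-≤ n (λ i i≤n → f≈ (suc i) (s≤s i≤n)) (λ i i≤n → g≈ i (ℕ.m≤n⇒m≤1+n i≤n)))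

  conv-cong : ∀ {f f′ g g′} → f ≋ f′ → g ≋ g′ → conv f g ≋ conv f′ g′
  conv-cong f≈ g≈ n = conv-cong-≤ n (λ i _ → f≈ i) (λ i _ → g≈ i)

  conv-zeroˡ : ∀ g → conv (λ _ → 0#) g ≋ λ _ → 0#
  conv-zeroˡ g zero    = zeroˡ (g 0)
  conv-zeroˡ g (suc n) = trans (+-cong (zeroˡ _) (conv-zeroˡ g n)) (+-identityˡ 0#)

  conv-identityˡ : ∀ g → conv one g ≋ g
  conv-identityˡ g zero    = *-identityˡ (g 0)
  conv-identityˡ g (suc n) = trans (+-cong (*-identityˡ _) (conv-zeroˡ g n)) (+-identityʳ _)

  conv-distribʳ : ∀ h f g → conv (λ n → f n + g n) h ≋ λ n → conv f h n + conv g h n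
  conv-distribʳ h f g zero    = distribʳ (h 0) (f 0) (g 0)
  conv-distribʳ h f g (suc n) =
    trans (+-cong (distribʳ (h (suc n)) (f 0) (g 0)) (conv-distribʳ h (f ∘ suc) (g ∘ suc) n))
          (interchange _ _ _ _)

  conv-scaleˡ : ∀ a g h → conv (λ n → a * g n) h ≋ λ n → a * conv g h n
  conv-scaleˡ a g h zero    = *-assoc a (g 0) (h 0)
  conv-scaleˡ a g h (suc n) =
    trans (+-cong (*-assoc a (g 0) (h (suc n))) (conv-scaleˡ a (g ∘ suc) h n))
          (sym (distribˡ a _ _))

  -- Splits off the last term where the definition splits off the first; commutativity needs both.
  conv-suc : ∀ f g n → conv f g (suc n) ≈ conv f (g ∘ suc) n + f (suc n) * g 0
  conv-suc f g zero    = refl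
  conv-suc f g (suc n) = trans (+-congˡ (conv-suc (f ∘ suc) g n)) (sym (+-assoc _ _ _))

  conv-comm : ∀ f g → conv f g ≋ conv g f
  conv-comm f g zero    = *-comm (f 0) (g 0)
  conv-comm f g (suc n) = begin
    f 0 * g (suc n) + conv (f ∘ suc) g n ≈⟨ +-cong (*-comm _ _) (conv-comm (f ∘ suc) g n) ⟩
    g (suc n) * f 0 + conv g (f ∘ suc) n ≈⟨ +-comm _ _ ⟩
    conv g (f ∘ suc) n + g (suc n) * f 0 ≈⟨ conv-suc g f n ⟨
    conv g f (suc n)                     ∎

  conv-assoc : ∀ f g h → conv (conv f g) h ≋ conv f (conv g h)
  conv-assoc f g h zero    = *-assoc (f 0) (g 0) (h 0)
  conv-assoc f g h (suc n) = begin
    f 0 * g 0 * h (suc n) + conv (conv f g ∘ suc) h n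
      ≈⟨ +-congˡ (conv-distribʳ h (λ i → f 0 * g (suc i)) (conv (f ∘ suc) g) n) ⟩
    f 0 * g 0 * h (suc n) + (conv (λ i → f 0 * g (suc i)) h n + conv (conv (f ∘ suc) g) h n)
      ≈⟨ +-cong (*-assoc _ _ _) (+-cong (conv-scaleˡ (f 0) (g ∘ suc) h n) (conv-assoc (f ∘ suc) g h n)) ⟩
    f 0 * (g 0 * h (suc n)) + (f 0 * conv (g ∘ suc) h n + conv (f ∘ suc) (conv g h) n)
      ≈⟨ +-assoc _ _ _ ⟨
    f 0 * (g 0 * h (suc n)) + f 0 * conv (g ∘ suc) h n + conv (f ∘ suc) (conv g h) n
      ≈⟨ +-congʳ (distribˡ (f 0) _ _) ⟨
    f 0 * conv g h (suc n) + conv (f ∘ suc) (conv g h) n ∎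

  series : CommutativeRing c ℓ
  series = record
    { Carrier = ℕ → Carrier
    ; _≈_ = _≋_
    ; _+_ = λ f g n → f n + g n
    ; _*_ = conv
    ; -_ = λ f n → - f n
    ; 0# = λ _ → 0#
    ; 1# = one
    ; isCommutativeRing = record
      { isRing = record
        { +-isAbelianGroup = Pointwise.isAbelianGroup ℕ +-isAbelianGroup
        ; *-cong = conv-cong
        ; *-assoc = conv-assoc
        ; *-identity = conv-identityˡ , λ f n → trans (conv-comm f one n) (conv-identityˡ f n)
        ; distrib = (λ h f g n → trans (conv-comm h _ n) (trans (conv-distribʳ h f g n)
                                   (+-cong (conv-comm f h n) (conv-comm g h n))))
                  , conv-distribʳ
        }
      ; *-comm = conv-comm
      }
    }

  X-conv-zero : ∀ f → conv X f 0 ≈ 0#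
  X-conv-zero f = zeroˡ (f 0)

  X-conv-suc : ∀ f n → conv X f (suc n) ≈ f n
  X-conv-suc f n = begin
    0# * f (suc n) + conv one f n ≈⟨ +-cong (zeroˡ _) (conv-identityˡ f n) ⟩
    0# + f n                      ≈⟨ +-identityˡ _ ⟩
    f n                           ∎

  infix 4 _≈[_]_
  -- Congruence modulo X^k, the form in which limits of series are taken.
  _≈[_]_ : (ℕ → Carrier) → ℕ → (ℕ → Carrier) → Set ℓ
  f ≈[ k ] g = ∀ i → i < k → f i ≈ g i

  conv-cong-[] : ∀ {f f′ g g′ k} → f ≈[ k ] f′ → g ≈[ k ] g′ → conv f g ≈[ k ] conv f′ g′
  conv-cong-[] f≈ g≈ i i<k =
    conv-cong-≤ i (λ j j≤i → f≈ j (ℕ.≤-<-trans j≤i i<k)) (λ j j≤i → g≈ j (ℕ.≤-<-trans j≤i i<k))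

  -- A factor without constant term shifts its cofactor by at least one place, so one more
  -- coefficient agrees.
  conv-raise : ∀ {z f g k} → z 0 ≈ 0# → f ≈[ k ] g → conv z f ≈[ suc k ] conv z g
  conv-raise {z} {f} {g} z₀ f≈g = raise
    where
    z₀* : ∀ a b → z 0 * a ≈ z 0 * b
    z₀* a b = trans (vanish a) (sym (vanish b))
      where
      vanish : ∀ a → z 0 * a ≈ 0#
      vanish a = trans (*-congʳ z₀) (zeroˡ a)
    raise : conv z f ≈[ suc _ ] conv z g
    raise zero    _         = z₀* (f 0) (g 0)
    raise (suc i) (s≤s i<k) = +-cong (z₀* (f (suc i)) (g (suc i))) (conv-cong-[] (λ _ _ → refl) f≈g i i<k)

  -- No inverse of 1 + z is constructed: if f and g agree below k, then z f and z g agree below k +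
  -- 1 by `conv-raise`, and subtracting them from the hypothesis makes f and g agree below k + 1.
  1+z-cancelˡ : ∀ {z f g} → z 0 ≈ 0# →
                (∀ n → f n + conv z f n ≈ g n + conv z g n) → ∀ n → f n ≈ g n
  1+z-cancelˡ {z} {f} {g} z₀ eq n = below (suc n) n (ℕ.n<1+n n)
    where
    open import Algebra.Properties.AbelianGroup +-abelianGroup using (∙-cancelʳ)
    below : ∀ k → f ≈[ k ] g
    below (suc k) i i<1+k = ∙-cancelʳ _ _ _
      (trans (eq i) (+-congˡ (sym (conv-raise {z} {f} {g} z₀ (below k) i i<1+k))))

-- A finite form of Gauss's identity

module FiniteGauss {c ℓ : Level} (R : CommutativeRing c ℓ) where

  open CommutativeRing R
  open import Algebra.Properties.CommutativeSemiring.Exp commutativeSemiring using (_^_; ^-congˡ; ^-congʳ; ^-homo-*; ^-distrib-*)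
  open import Algebra.Properties.Group +-group using (∙-cancelʳ; ⁻¹-involutive)
  open import Algebra.Properties.Ring ring using (-‿distribˡ-*; -‿distribʳ-*)
  open import Relation.Binary.Reasoning.Setoid setoid
  open SemiringSolver commutativeSemiring using (solve; _:+_; _:*_; _:=_; con)

  -- Thus e q n = (−1)ⁿ q^(n²), T q n = Σ_(−n<j≤n) (−1)ʲ q^(j²), and finite-gauss
  -- reads F n · T q n = (1 + qⁿ) · Σ_(s<n) (−qⁿ)ˢ F s, with terms moved so that the
  -- only negations are those inside y and a semiring solver suffices.
  y[_^_] : Carrier → ℕ → Carrier
  y[ q ^ n ] = - (q ^ n)

  e : Carrier → ℕ → Carrier
  e q n = y[ q ^ n ] ^ n

  T : Carrier → ℕ → Carrier
  T q zero    = 0#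
  T q (suc n) = T q n + (e q n + e q (suc n))

  W : (ℕ → Carrier) → ℕ → Carrier → Carrier
  W F zero    y = 0#
  W F (suc m) y = W F m y + y ^ m * F m

  module _ (q : Carrier) (F : ℕ → Carrier)
           (F-rec : ∀ s → F (suc s) ≈ F s + (q ^ suc s) * (F (suc s) + F s)) where

    -- Summation by parts. Here `W F m y` is the sum of y^s F s over s < m. Passing from y to z = y
    -- q multiplies the term s by q^s, and `F-rec` turns q^(s+1) (F (s + 1) + F s) into a
    -- difference, so that the sums telescope.
    W-step : ∀ m y → let z = y * q in
             (1# + z) * W F (suc m) z + y * W F m y ≈ W F m y + (y ^ m + z ^ suc m) * F m
    W-step zero y = solve 3 (λ y q f →
        (con 1 :+ y :* q) :* (con 0 :+ con 1 :* f) :+ y :* con 0 :=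
        con 0 :+ (con 1 :+ (y :* q) :* con 1) :* f) refl y q (F 0)
    W-step (suc m) y = begin
      (1# + z) * (Wz + zᵐ⁺¹ * F′) + y * (Wy + yᵐ * F₀)
        ≈⟨ solve 8 (λ z zm y ym wz wy f f′ →
             (con 1 :+ z) :* (wz :+ zm :* f′) :+ y :* (wy :+ ym :* f) :=
             ((con 1 :+ z) :* wz :+ y :* wy) :+ ((con 1 :+ z) :* zm :* f′ :+ y :* ym :* f))
             refl z zᵐ⁺¹ y yᵐ Wz Wy F₀ F′ ⟩
      ((1# + z) * Wz + y * Wy) + ((1# + z) * zᵐ⁺¹ * F′ + y * yᵐ * F₀)
        ≈⟨ +-congʳ (W-step m y) ⟩
      (Wy + (yᵐ + zᵐ⁺¹) * F₀) + ((1# + z) * zᵐ⁺¹ * F′ + y * yᵐ * F₀)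
        ≈⟨ solve 7 (λ z zm y ym wy f f′ →
             (wy :+ (ym :+ zm) :* f) :+ ((con 1 :+ z) :* zm :* f′ :+ y :* ym :* f) :=
             ((wy :+ ym :* f) :+ z :* zm :* f′) :+ (y :* ym :* f :+ zm :* (f′ :+ f)))
             refl z zᵐ⁺¹ y yᵐ Wy F₀ F′ ⟩
      ((Wy + yᵐ * F₀) + z * zᵐ⁺¹ * F′) + (y * yᵐ * F₀ + zᵐ⁺¹ * (F′ + F₀))
        -- The power of z is split as y^(m+1) q^(m+1) to expose the right-hand side of `F-rec`.
        ≈⟨ +-congˡ (+-congˡ (*-congʳ (^-distrib-* y q (suc m)))) ⟩
      ((Wy + yᵐ * F₀) + z * zᵐ⁺¹ * F′) + (y * yᵐ * F₀ + y * yᵐ * (q ^ suc m) * (F′ + F₀))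
        ≈⟨ +-congˡ (solve 4 (λ ym f qm g → ym :* f :+ ym :* qm :* g := ym :* (f :+ qm :* g))
             refl (y * yᵐ) F₀ (q ^ suc m) (F′ + F₀)) ⟩
      ((Wy + yᵐ * F₀) + z * zᵐ⁺¹ * F′) + y * yᵐ * (F₀ + (q ^ suc m) * (F′ + F₀))
        ≈⟨ +-congˡ (*-congˡ (F-rec m)) ⟨
      ((Wy + yᵐ * F₀) + z * zᵐ⁺¹ * F′) + y * yᵐ * F′
        ≈⟨ solve 4 (λ w zm ym f → (w :+ zm :* f) :+ ym :* f := w :+ (ym :+ zm) :* f)
             refl (Wy + yᵐ * F₀) (z * zᵐ⁺¹) (y * yᵐ) F′ ⟩
      (Wy + yᵐ * F₀) + (y * yᵐ + z * zᵐ⁺¹) * F′ ∎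
      where
      z = y * q
      zᵐ⁺¹ = z ^ suc m
      yᵐ = y ^ m
      Wz = W F (suc m) z
      Wy = W F m y
      F₀ = F m
      F′ = F (suc m)

    module _ (cancel : ∀ n {a b} → (1# + y[ q ^ suc n ]) * a ≈ (1# + y[ q ^ suc n ]) * b → a ≈ b) where

      finite-gauss : ∀ n → F n * T q n + y[ q ^ n ] * W F n y[ q ^ n ] ≈ W F n y[ q ^ n ]
      finite-gauss zero    = trans (+-cong (zeroʳ _) (zeroʳ _)) (+-identityˡ 0#)
      finite-gauss (suc n) = cancel n (begin
        (1# + z) * (F′ * T′ + z * Wz)
          ≈⟨ solve 4 (λ z f t w → (con 1 :+ z) :* (f :* t :+ z :* w) :=
                                  (con 1 :+ z) :* f :* t :+ z :* ((con 1 :+ z) :* w)) refl z F′ T′ Wz ⟩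
        (1# + z) * F′ * T′ + z * ((1# + z) * Wz)
          ≈⟨ +-congˡ (*-congˡ FT′) ⟨
        (1# + z) * F′ * T′ + z * (F₀ * T′)
          ≈⟨ solve 4 (λ z f′ t f → (con 1 :+ z) :* f′ :* t :+ z :* (f :* t) :=
                                   ((con 1 :+ z) :* f′ :+ z :* f) :* t) refl z F′ T′ F₀ ⟩
        ((1# + z) * F′ + z * F₀) * T′
          ≈⟨ *-congʳ F-rec′ ⟩
        F₀ * T′
          ≈⟨ FT′ ⟩
        (1# + z) * Wz ∎)
        where
        y = y[ q ^ n ]
        z = y[ q ^ suc n ]
        F₀ = F n
        F′ = F (suc n)
        T′ = T q (suc n)
        Wz = W F (suc n) z
        Wy = W F n y

        yq≈z : y * q ≈ z
        yq≈z = trans (sym (-‿distribˡ-* (q ^ n) q)) (-‿cong (*-comm (q ^ n) q))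

        W-cong : ∀ m {u v} → u ≈ v → W F m u ≈ W F m v
        W-cong zero    u≈v = refl
        W-cong (suc m) u≈v = +-cong (W-cong m u≈v) (*-congʳ (^-congˡ m u≈v))

        -- The old F meets the new theta sum: the induction hypothesis trades `F n * T q n` for
        -- `W F n y`, and the two terms added to `T` are y^n and z^(n+1), as in `W-step`.
        FT′ : F₀ * T′ ≈ (1# + z) * Wz
        FT′ = ∙-cancelʳ _ _ _ (begin
          F₀ * T′ + y * Wy
            ≈⟨ solve 5 (λ f t a b w → f :* (t :+ (a :+ b)) :+ w := (f :* t :+ w) :+ (a :+ b) :* f)
                 refl F₀ (T q n) (e q n) (e q (suc n)) (y * Wy) ⟩
          (F₀ * T q n + y * Wy) + (e q n + e q (suc n)) * F₀
            ≈⟨ +-congʳ (finite-gauss n) ⟩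
          Wy + (e q n + e q (suc n)) * F₀
            ≈⟨ +-congˡ (*-congʳ (+-congˡ (^-congˡ (suc n) yq≈z))) ⟨
          Wy + (y ^ n + (y * q) ^ suc n) * F₀
            ≈⟨ W-step n y ⟨
          (1# + y * q) * W F (suc n) (y * q) + y * Wy
            ≈⟨ +-congʳ (*-cong (+-congˡ yq≈z) (W-cong (suc n) yq≈z)) ⟩
          (1# + z) * Wz + y * Wy ∎)

        -- This is (1 - q^(n+1)) F (n + 1) = (1 + q^(n+1)) F n, the factor of the generating product
        -- for parts of size n + 1.
        F-rec′ : (1# + z) * F′ + z * F₀ ≈ F₀
        F-rec′ = begin
          (1# + z) * F′ + z * F₀
            ≈⟨ solve 3 (λ z f′ f → (con 1 :+ z) :* f′ :+ z :* f := f′ :+ z :* (f′ :+ f)) refl z F′ F₀ ⟩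
          F′ + z * (F′ + F₀)
            ≈⟨ +-cong (F-rec n) (sym (-‿distribˡ-* (q ^ suc n) (F′ + F₀))) ⟩
          (F₀ + (q ^ suc n) * (F′ + F₀)) - (q ^ suc n) * (F′ + F₀)
            ≈⟨ +-assoc _ _ _ ⟩
          F₀ + ((q ^ suc n) * (F′ + F₀) - (q ^ suc n) * (F′ + F₀))
            ≈⟨ +-congˡ (-‿inverseʳ _) ⟩
          F₀ + 0#
            ≈⟨ +-identityʳ F₀ ⟩
          F₀ ∎

  -- The sign is (-1)^(n + n²) = 1, as n and n² have the same parity. The induction uses (n + 1)² =
  -- n² + 1 + 2 n and pairs the factors -x.
  e-neg : ∀ x n → e (- x) n ≈ x ^ (n ℕ.* n)
  e-neg x zero    = refl
  e-neg x (suc n) = begin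
    z ^ suc n
      ≈⟨ ^-congˡ (suc n) z≈yq ⟩
    (y * q) ^ suc n
      ≈⟨ ^-distrib-* y q (suc n) ⟩
    (y * y ^ n) * (q * q ^ n)
      ≈⟨ solve 4 (λ y yⁿ q qⁿ → (y :* yⁿ) :* (q :* qⁿ) := yⁿ :* ((y :* q) :* qⁿ)) refl y (y ^ n) q (q ^ n) ⟩
    y ^ n * ((y * q) * q ^ n)
      ≈⟨ *-cong (e-neg x n) (*-congʳ (trans (sym z≈yq) z≈xqⁿ)) ⟩
    x ^ (n ℕ.* n) * ((x * q ^ n) * q ^ n)
      ≈⟨ *-congˡ (trans (*-assoc _ _ _) (*-congˡ (sym (^-distrib-* q q n)))) ⟩
    x ^ (n ℕ.* n) * (x * (q * q) ^ n)
      ≈⟨ *-congˡ (*-congˡ (^-congˡ n qq≈xx)) ⟩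
    x ^ (n ℕ.* n) * (x * (x * x) ^ n)
      ≈⟨ *-congˡ (*-congˡ (trans (^-distrib-* x x n) (sym (^-homo-* x n n)))) ⟩
    x ^ (n ℕ.* n) * (x ^ suc (n ℕ.+ n))
      ≈⟨ ^-homo-* x (n ℕ.* n) (suc (n ℕ.+ n)) ⟨
    x ^ (n ℕ.* n ℕ.+ suc (n ℕ.+ n))
      ≈⟨ ^-congʳ x (ℕ-solve 1 (λ n → n ⊗ n ⊕ (κ 1 ⊕ (n ⊕ n)) ⊜ (κ 1 ⊕ n) ⊗ (κ 1 ⊕ n)) ≡.refl n) ⟩
    x ^ (suc n ℕ.* suc n) ∎
    where
    open ℕ-Solver using () renaming (solve to ℕ-solve; _:+_ to _⊕_; _:*_ to _⊗_; _:=_ to _⊜_; con to κ)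
    q = - x
    y = y[ q ^ n ]
    z = y[ q ^ suc n ]
    z≈yq : z ≈ y * q
    z≈yq = trans (-‿cong (*-comm q (q ^ n))) (-‿distribˡ-* (q ^ n) q)
    qq≈xx : q * q ≈ x * x
    qq≈xx = trans (sym (-‿distribˡ-* x (- x))) (trans (-‿cong (sym (-‿distribʳ-* x x))) (⁻¹-involutive _))
    z≈xqⁿ : z ≈ x * q ^ n
    z≈xqⁿ = trans (-‿cong (sym (-‿distribˡ-* x (q ^ n)))) (⁻¹-involutive _)

-- Fifth powers in characteristic 5

module Frobenius₅ {c ℓ : Level} (K : CommutativeRing c ℓ) where

  open CommutativeRing K

  _⁵ : Carrier → Carrier
  x ⁵ = x * x * x * x * x

  open PowerSeries K
  private module S = CommutativeRing series

  -- The substitution of q⁵ for q.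
  dilate : (ℕ → Carrier) → ℕ → Carrier
  dilate f 0 = f 0
  dilate f 1 = 0#
  dilate f 2 = 0#
  dilate f 3 = 0#
  dilate f 4 = 0#
  dilate f (suc (suc (suc (suc (suc n))))) = dilate (f ∘ suc) n

  -- A series in q⁵ passes through the extraction of every fifth coefficient: in the product only
  -- every fifth term of the first factor is nonzero, and it meets a coefficient of g whose index is
  -- again a multiple of 5.
  section-dilate : ∀ f g n → (dilate f S.* g) (n ℕ.* 5) ≈ (f S.* λ i → g (i ℕ.* 5)) n
  section-dilate f g zero    = refl
  section-dilate f g (suc n) = +-congˡ (0*+ (0*+ (0*+ (0*+ (section-dilate (f ∘ suc) g n)))))
    where
    0*+ : ∀ {x y z} → y ≈ z → 0# * x + y ≈ z
    0*+ y≈z = trans (+-cong (zeroˡ _) y≈z) (+-identityˡ _)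

  module _ (5x≈0 : ∀ x → x + x + x + x + x ≈ 0#) (x⁵≈x : ∀ x → x ⁵ ≈ x) where

    constant : Carrier → ℕ → Carrier
    constant a zero    = a
    constant a (suc _) = 0#

    constant-conv : ∀ a f n → (constant a S.* f) n ≈ a * f n
    constant-conv a f zero    = refl
    constant-conv a f (suc n) = trans (+-congˡ (conv-zeroˡ f n)) (+-identityʳ _)

    _⁵ˢ : (ℕ → Carrier) → ℕ → Carrier
    f ⁵ˢ = f S.* f S.* f S.* f S.* f

    constant-⁵ : ∀ a → constant a ⁵ˢ S.≈ constant a
    constant-⁵ a = S.trans (times (times (times (mult a a)))) step
      where
      mult : ∀ a b → constant a S.* constant b S.≈ constant (a * b)
      mult a b n = trans (constant-conv a (constant b) n) (lemma n)
        where
        lemma : ∀ n → a * constant b n ≈ constant (a * b) n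
        lemma zero    = refl
        lemma (suc n) = zeroʳ a
      times : ∀ {f b} → f S.≈ constant b → f S.* constant a S.≈ constant (b * a)
      times {b = b} f≈b = S.trans (S.*-congʳ {constant a} f≈b) (mult b a)
      step : constant (a ⁵) S.≈ constant a
      step zero    = x⁵≈x a
      step (suc n) = refl

    -- The mixed binomial coefficients are 5, 10, 10, 5, so the mixed terms add up to five times
    -- `M`.
    +-⁵ : ∀ f g → (f S.+ g) ⁵ˢ S.≈ f ⁵ˢ S.+ g ⁵ˢ
    +-⁵ f g = S.trans expand (S.trans (S.+-congˡ {f ⁵ˢ S.+ g ⁵ˢ} (λ n → 5x≈0 (M n))) (S.+-identityʳ (f ⁵ˢ S.+ g ⁵ˢ)))
      where
      open SemiringSolver S.commutativeSemiring using (solve; _:+_; _:*_; _:=_)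
      M = f S.* f S.* f S.* f S.* g S.+ (f S.* f S.* f S.* g S.* g S.+ f S.* f S.* f S.* g S.* g)
          S.+ (f S.* f S.* g S.* g S.* g S.+ f S.* f S.* g S.* g S.* g) S.+ f S.* g S.* g S.* g S.* g
      expand : (f S.+ g) ⁵ˢ S.≈ (f ⁵ˢ S.+ g ⁵ˢ) S.+ (M S.+ M S.+ M S.+ M S.+ M)
      expand = solve 2 (λ f g →
        let m = f :* f :* f :* f :* g :+ (f :* f :* f :* g :* g :+ f :* f :* f :* g :* g)
                :+ (f :* f :* g :* g :* g :+ f :* f :* g :* g :* g) :+ f :* g :* g :* g :* g in
        (f :+ g) :* (f :+ g) :* (f :+ g) :* (f :+ g) :* (f :+ g) :=
        (f :* f :* f :* f :* f :+ g :* g :* g :* g :* g) :+ (m :+ m :+ m :+ m :+ m)) S.refl f g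

    decompose : ∀ f → f S.≈ constant (f 0) S.+ X S.* (f ∘ suc)
    decompose f zero    = sym (trans (+-congˡ (X-conv-zero (f ∘ suc))) (+-identityʳ (f 0)))
    decompose f (suc n) = sym (trans (+-congˡ (X-conv-suc (f ∘ suc) n)) (+-identityˡ (f (suc n))))

    -- Writing f = f(0) + X g gives f⁵ = f(0) + X⁵ g⁵ by `+-⁵` and Fermat's theorem for the
    -- constant; the recursion continues with g, five places lower.
    frobenius : ∀ f → f ⁵ˢ S.≈ dilate f
    frobenius f n = trans (⁵-expand n) (step n)
      where
      open SemiringSolver S.commutativeSemiring using (solve; _:*_; _:=_)
      g = f ∘ suc
      h₀ h₁ h₂ h₃ h₄ : ℕ → Carrier
      h₀ = g ⁵ˢ
      h₁ = X S.* h₀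
      h₂ = X S.* h₁
      h₃ = X S.* h₂
      h₄ = X S.* h₃
      cong₅ : ∀ {f h} → f S.≈ h → f ⁵ˢ S.≈ h ⁵ˢ
      cong₅ e = S.*-cong (S.*-cong (S.*-cong (S.*-cong e e) e) e) e
      ⁵-expand : f ⁵ˢ S.≈ constant (f 0) S.+ X S.* h₄
      ⁵-expand = S.trans (cong₅ (decompose f)) (S.trans (+-⁵ (constant (f 0)) (X S.* g))
        (S.+-cong (constant-⁵ (f 0)) (solve 2 (λ x g →
          (x :* g) :* (x :* g) :* (x :* g) :* (x :* g) :* (x :* g) :=
          x :* (x :* (x :* (x :* (x :* (g :* g :* g :* g :* g)))))) S.refl X g)))
      0+ : ∀ {x y} → x ≈ y → 0# + x ≈ y
      0+ x≈y = trans (+-identityˡ _) x≈y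
      step : ∀ n → constant (f 0) n + (X S.* h₄) n ≈ dilate f n
      step 0 = trans (+-congˡ (X-conv-zero h₄)) (+-identityʳ (f 0))
      step 1 = 0+ (trans (X-conv-suc h₄ 0) (X-conv-zero h₃))
      step 2 = 0+ (trans (X-conv-suc h₄ 1) (trans (X-conv-suc h₃ 0) (X-conv-zero h₂)))
      step 3 = 0+ (trans (X-conv-suc h₄ 2) (trans (X-conv-suc h₃ 1) (trans (X-conv-suc h₂ 0) (X-conv-zero h₁))))
      step 4 = 0+ (trans (X-conv-suc h₄ 3) (trans (X-conv-suc h₃ 2) 
                 (trans (X-conv-suc h₂ 1) (trans (X-conv-suc h₁ 0) (X-conv-zero h₀)))))
      step (suc (suc (suc (suc (suc n))))) =
        0+ (trans (X-conv-suc h₄ (4 ℕ.+ n)) (trans (X-conv-suc h₃ (3 ℕ.+ n)) 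
           (trans (X-conv-suc h₂ (2 ℕ.+ n)) (trans (X-conv-suc h₁ (suc n)) (trans (X-conv-suc h₀ n) (frobenius g n))))))

open import Defs
open import Data.Bool using (true; false; if_then_else_)
open import Data.Empty using (⊥-elim)
open import Data.Fin as Fin using (Fin; toℕ)
import Data.Fin.Properties as Fin
open import Data.Fin.Properties using (all?; toℕ-fromℕ<)
open import Data.Integer as ℤ using (ℤ; +_; -[1+_]; 0ℤ; 1ℤ)
import Data.Integer.Divisibility.Signed as ℤ∣
import Data.Integer.DivMod as ℤ
import Data.Integer.Properties as ℤ
open import Data.Integer.Solver using () renaming (module +-*-Solver to ℤ-Solver)
open import Data.List using (List; []; _∷_; _++_; length; map; filter; cartesianProduct)
open import Data.List.Membership.Propositional using (_∈_)
open import Data.List.Membership.Propositional.Properties using (∈-map⁺; ∈-map⁻; ∈-filter⁺; ∈-filter⁻; ∈-++⁺ˡ; ∈-++⁺ʳ; ∈-++⁻; ∈-cartesianProduct⁺; ∈-cartesianProduct⁻)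
open import Data.List.Membership.Propositional.Properties.WithK using (unique∧set⇒bag)
open import Data.List.Properties using (length-++; length-map; ∷-injectiveʳ)
open import Data.List.Relation.Binary.BagAndSetEquality using (∼bag⇒↭)
open import Data.List.Relation.Binary.Disjoint.Propositional using (Disjoint)
open import Data.List.Relation.Binary.Permutation.Propositional.Properties using (↭-length)
open import Data.List.Relation.Unary.All as All using (_∷_)
open import Data.List.Relation.Unary.AllPairs using ([]; _∷_)
open import Data.List.Relation.Unary.Any using (here; there)
open import Data.List.Relation.Unary.Linked using ([]; [-]; _∷_)
open import Data.List.Relation.Unary.Unique.Propositional using (Unique)
import Data.List.Relation.Unary.Unique.Propositional.Properties as Unique
open import Data.Nat using (_+_; _*_; _^_; _≤?_; _≟_; _≡ᵇ_)
open import Data.Nat.Divisibility using (_∣_; n∣m⇒m%n≡0)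
open import Data.Nat.DivMod using (_%_; _/_; _divMod_; result; m≡m%n+[m/n]*n; m*n%n≡0; [m+kn]%n≡m%n)
open import Data.Nat.LCM using (lcm-least)
open import Data.Nat.ListAction using (sum)
open import Data.Nat.Properties
open import Algebra.Properties.CommutativeSemigroup +-commutativeSemigroup using (x∙yz≈y∙xz)
open import Data.Sum using (_⊎_; inj₁; inj₂)
open import Data.Unit using (⊤; tt)
import Relation.Binary.Reasoning.Setoid as SetoidReasoning
open import Relation.Binary.PropositionalEquality using (_≡_; _≢_; refl; sym; trans; cong; cong₂; subst; subst₂; module ≡-Reasoning)
open import Relation.Nullary using (Dec; yes; does; ¬_; ¬?; contradiction)
open import Relation.Nullary.Decidable using (from-yes; _×-dec_; _→-dec_; does-⇔)

open ℤ∣ using () renaming (_∣_ to _∣ℤ_)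

-- Counting overpartitions

unique-length : {A : Set} {xs ys : List A} → Unique xs → Unique ys →
                (∀ {x} → x ∈ xs → x ∈ ys) → (∀ {x} → x ∈ ys → x ∈ xs) → length xs ≡ length ys
unique-length uxs uys to from = ↭-length (∼bag⇒↭ (unique∧set⇒bag uxs uys (mk⇔ to from)))

Starts : (Part → Set) → List Part → Set
Starts P []      = ⊤
Starts P (p ∷ _) = P p

starts? : {P : Part → Set} → (∀ p → Dec (P p)) → ∀ ps → Dec (Starts P ps)
starts? P? []      = yes tt
starts? P? (p ∷ _) = P? p

-- Whether a list may follow a part of size s does not depend on the overlining
-- of that part, so false stands for both values here.
bounded following : ℕ → ℕ → List (List Part)
bounded   s n = filter (starts? (λ p → proj₁ p ≤? s)) (overpartitions n)
following s n = filter (starts? ((s , false) ≽?_)) (overpartitions n)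

-- Multiplication by q^k, for sequences of lists as well as of coefficients; `d` plays the part of
-- zero below index k.
delay : {A : Set} → A → ℕ → (ℕ → A) → ℕ → A
delay d zero    L n       = L n
delay d (suc k) L zero    = d
delay d (suc k) L (suc n) = delay d k L n

∈-delay⁻ : {A : Set} {x : A} → ∀ k L n → x ∈ delay [] k L n → ∃ λ m → n ≡ k + m × x ∈ L m
∈-delay⁻ zero    L n       x∈ = n , refl , x∈
∈-delay⁻ (suc k) L (suc n) x∈ with m , n≡ , x∈L ← ∈-delay⁻ k L n x∈ = m , cong suc n≡ , x∈L

∈-delay⁺ : {A : Set} {x : A} → ∀ k L m → x ∈ L m → x ∈ delay [] k L (k + m)
∈-delay⁺ zero    L m x∈ = x∈
∈-delay⁺ (suc k) L m x∈ = ∈-delay⁺ k L m x∈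

delay-unique : {A : Set} → ∀ k (L : ℕ → List A) → (∀ m → Unique (L m)) → ∀ n → Unique (delay [] k L n)
delay-unique zero    L u n       = u n
delay-unique (suc k) L u zero    = []
delay-unique (suc k) L u (suc n) = delay-unique k L u n

∷-overpartition⁺ : ∀ {s b m ps} → IsOverpartition m ps → Starts ((suc s , b) ≽_) ps →
                   IsOverpartition (suc s + m) ((suc s , b) ∷ ps)
∷-overpartition⁺ {ps = []}     (isOverpartition pos ord refl) st = isOverpartition (s≤s z≤n ∷ pos) [-] refl
∷-overpartition⁺ {ps = p ∷ ps} (isOverpartition pos ord refl) st = isOverpartition (s≤s z≤n ∷ pos) (st ∷ ord) refl

∷-overpartition⁻ : ∀ {a b n ps} → IsOverpartition n ((a , b) ∷ ps) →
                   IsOverpartition (sum (map proj₁ ps)) ps × Starts ((a , b) ≽_) ps × n ≡ a + sum (map proj₁ ps)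
∷-overpartition⁻ (isOverpartition (_ ∷ pos) [-]        refl) = isOverpartition pos [] refl , tt , refl
∷-overpartition⁻ (isOverpartition (_ ∷ pos) (st ∷ ord) refl) = isOverpartition pos ord refl , st , refl

private
  unique-filtered : {P : Part → Set} (P? : ∀ p → Dec (P p)) → ∀ n → Unique (filter (starts? P?) (overpartitions n))
  unique-filtered P? n = Unique.filter⁺ (starts? P?) (overpartitions-unique n)

  member : {P : Part → Set} (P? : ∀ p → Dec (P p)) → ∀ {n ps} →
           IsOverpartition n ps → Starts P ps → ps ∈ filter (starts? P?) (overpartitions n)
  member P? {n} {ps} o st = ∈-filter⁺ (starts? P?) (Equivalence.from (∈-overpartitions n ps) o) st

  member⁻ : {P : Part → Set} (P? : ∀ p → Dec (P p)) → ∀ {n ps} →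
            ps ∈ filter (starts? P?) (overpartitions n) → IsOverpartition n ps × Starts P ps
  member⁻ P? {n} {ps} ps∈ with ps∈′ , st ← ∈-filter⁻ (starts? P?) {xs = overpartitions n} ps∈ =
    Equivalence.to (∈-overpartitions n ps) ps∈′ , st

  -- Q admits exactly one more first part than P. Removing that part leaves an overpartition that
  -- may follow it, of a number smaller by `suc s`.
  starts-split : ∀ {P Q : Part → Set} (P? : ∀ p → Dec (P p)) (Q? : ∀ p → Dec (Q p)) s b →
    (∀ {p} → P p → Q p) → Q (suc s , b) → ¬ P (suc s , b) → (∀ {p} → Q p → P p ⊎ p ≡ (suc s , b)) →
    ∀ n → length (filter (starts? Q?) (overpartitions n)) ≡
          length (filter (starts? P?) (overpartitions n)) + length (delay [] (suc s) (following (suc s)) n)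
  starts-split {P} {Q} P? Q? s b P⇒Q Qp ¬Pp split n = begin
    length (filter (starts? Q?) (overpartitions n))
      ≡⟨ unique-length (unique-filtered Q? n)
           (Unique.++⁺ (unique-filtered P? n) (Unique.map⁺ ∷-injectiveʳ (delay-unique (suc s) _ (unique-filtered _) n)) disjoint)
           to from ⟩
    length (filter (starts? P?) (overpartitions n) ++ map ((suc s , b) ∷_) D)
      ≡⟨ length-++ (filter (starts? P?) (overpartitions n)) ⟩
    length (filter (starts? P?) (overpartitions n)) + length (map ((suc s , b) ∷_) D)
      ≡⟨ cong (λ l → length (filter (starts? P?) (overpartitions n)) + l) (length-map _ D) ⟩
    length (filter (starts? P?) (overpartitions n)) + length D ∎
    where
    open ≡-Reasoning
    D = delay [] (suc s) (following (suc s)) n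
    follows? = (suc s , false) ≽?_

    disjoint : Disjoint (filter (starts? P?) (overpartitions n)) (map ((suc s , b) ∷_) D)
    disjoint (ps∈P , ps∈D) with _ , _ , refl ← ∈-map⁻ _ ps∈D = ¬Pp (proj₂ (member⁻ P? {n} ps∈P))

    to : ∀ {ps} → ps ∈ filter (starts? Q?) (overpartitions n) →
         ps ∈ filter (starts? P?) (overpartitions n) ++ map ((suc s , b) ∷_) D
    to {ps} ps∈ with member⁻ Q? {n} ps∈
    to {[]}     ps∈ | o , _ = ∈-++⁺ˡ (member P? o tt)
    to {p ∷ ps} ps∈ | o , q with split q
    ... | inj₁ pp   = ∈-++⁺ˡ (member P? o pp)
    ... | inj₂ refl with o′ , st , refl ← ∷-overpartition⁻ o =
      ∈-++⁺ʳ _ (∈-map⁺ _ (∈-delay⁺ (suc s) (following (suc s)) _ (member follows? o′ st)))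

    from : ∀ {ps} → ps ∈ filter (starts? P?) (overpartitions n) ++ map ((suc s , b) ∷_) D →
           ps ∈ filter (starts? Q?) (overpartitions n)
    from ps∈ with ∈-++⁻ (filter (starts? P?) (overpartitions n)) ps∈
    from {[]}     _ | inj₁ ps∈P = member Q? (proj₁ (member⁻ P? {n} ps∈P)) tt
    from {p ∷ ps} _ | inj₁ ps∈P with o , pp ← member⁻ P? {n} ps∈P = member Q? o (P⇒Q pp)
    from _ | inj₂ ps∈D with ps , ps∈ , refl ← ∈-map⁻ _ ps∈D
                       with m , refl , ps∈′ ← ∈-delay⁻ (suc s) (following (suc s)) n ps∈
                       with o , st ← member⁻ follows? {m} ps∈′ =
      member Q? (∷-overpartition⁺ o st) Qp

-- Such a list starts with a part of size at most s or with a plain s + 1. For the generating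
-- functions B of `bounded` and C of `following`: C(s+1) = B(s) + q^(s+1) C(s+1).
following-suc : ∀ s n → length (following (suc s) n) ≡
                        length (bounded s n) + length (delay [] (suc s) (following (suc s)) n)
following-suc s = starts-split _ _ s false (λ a≤s → inj₁ (s≤s a≤s)) (inj₂ (refl , refl)) (<⇒≱ (n<1+n s))
  λ { (inj₁ (s≤s a≤s)) → inj₁ a≤s ; (inj₂ (refl , refl)) → inj₂ refl }

-- The one additional first part is an overlined s + 1, whence B(s+1) = C(s+1) + q^(s+1) C(s+1).
bounded-suc : ∀ s n → length (bounded (suc s) n) ≡
                      length (following (suc s) n) + length (delay [] (suc s) (following (suc s)) n)
bounded-suc s = starts-split _ _ s true
  (λ { (inj₁ a<1+s) → <⇒≤ a<1+s ; (inj₂ (refl , _)) → ≤-refl }) ≤-refl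
  (λ { (inj₁ 1+s<1+s) → <-irrefl refl 1+s<1+s ; (inj₂ (_ , ())) })
  split
  where
  split : ∀ {p} → proj₁ p ≤ suc s → (suc s , false) ≽ p ⊎ p ≡ (suc s , true)
  split {a , b} a≤1+s with m≤n⇒m<n∨m≡n a≤1+s
  split {a , b}     _ | inj₁ a<1+s = inj₁ (inj₁ a<1+s)
  split {a , false} _ | inj₂ refl  = inj₁ (inj₂ (refl , refl))
  split {a , true}  _ | inj₂ refl  = inj₂ refl

bounded-zero-suc : ∀ n → length (bounded 0 (suc n)) ≡ 0
bounded-zero-suc n = unique-length (unique-filtered _ (suc n)) [] empty (λ ())
  where
  empty : ∀ {ps} → ps ∈ bounded 0 (suc n) → ps ∈ []
  empty {ps} ps∈ with member⁻ (λ p → proj₁ p ≤? 0) {suc n} ps∈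
  empty {[]}     _ | isOverpartition _ _ () , _
  empty {p ∷ ps} _ | isOverpartition (0<a ∷ _) _ _ , a≤0 = ⊥-elim (<⇒≱ 0<a a≤0)

bounded-all : ∀ {s n} → n ≤ s → length (bounded s n) ≡ p̄ n
bounded-all {s} {n} n≤s = unique-length (unique-filtered _ n) (overpartitions-unique n)
  (λ {ps} ps∈ → Equivalence.from (∈-overpartitions n ps) (proj₁ (member⁻ _ {n} ps∈)))
  λ {ps} ps∈ → let o = Equivalence.to (∈-overpartitions n ps) ps∈ in member _ o (starts o)
  where
  starts : ∀ {ps} → IsOverpartition n ps → Starts (λ p → proj₁ p ≤ s) ps
  starts {[]}     _ = tt
  starts {p ∷ ps} (isOverpartition _ _ refl) = ≤-trans (m≤m+n _ _) n≤s

-- The theta series φ and the identity A φ = 1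

-- A weight with finite fibres, each listed without repetition; `count` holds the coefficients of
-- its generating function.
record Enumeration {A : Set} (weight : A → ℕ) : Set where
  field
    fibre    : ℕ → List A
    unique   : ∀ n → Unique (fibre n)
    sound    : ∀ {n x} → x ∈ fibre n → weight x ≡ n
    complete : ∀ x → x ∈ fibre (weight x)

  count : ℕ → ℤ
  count n = + length (fibre n)

open Enumeration

square : ℤ → ℕ
square z = ℤ.∣ z ∣ * ℤ.∣ z ∣

-- The integers from -N to N - 1. The asymmetry matches `T`, whose step from j to j + 1 adds the
-- squares of j and of -(j + 1).
window : ℕ → List ℤ
window zero    = []
window (suc j) = + j ∷ -[1+ j ] ∷ window j

private
  ∈-window : ∀ {N} z → ℤ.∣ z ∣ < N → z ∈ window N
  ∈-window {suc N} (+ j)    (s≤s j≤N) with m≤n⇒m<n∨m≡n j≤N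
  ... | inj₁ j<N  = there (there (∈-window (+ j) j<N))
  ... | inj₂ refl = here refl
  ∈-window {suc N} -[1+ j ] (s≤s j<N) with m≤n⇒m<n∨m≡n j<N
  ... | inj₁ 1+j<N = there (there (∈-window -[1+ j ] 1+j<N))
  ... | inj₂ refl  = there (there (there (here refl)))

  window-bound : ∀ N {z} → z ∈ window N → (∃ λ j → z ≡ + j × j < N) ⊎ (∃ λ j → z ≡ -[1+ j ] × j < N)
  window-bound (suc N) (here refl)         = inj₁ (N , refl , n<1+n N)
  window-bound (suc N) (there (here refl)) = inj₂ (N , refl , n<1+n N)
  window-bound (suc N) (there (there z∈)) with window-bound N z∈
  ... | inj₁ (j , z≡ , j<N) = inj₁ (j , z≡ , m<n⇒m<1+n j<N)
  ... | inj₂ (j , z≡ , j<N) = inj₂ (j , z≡ , m<n⇒m<1+n j<N)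

  window-unique : ∀ N → Unique (window N)
  window-unique zero    = []
  window-unique (suc N) =
    ((λ ()) ∷ All.tabulate fresh⁺) ∷ All.tabulate fresh⁻ ∷ window-unique N
    where
    fresh⁺ : ∀ {z} → z ∈ window N → + N ≢ z
    fresh⁺ z∈ refl with window-bound N z∈
    ... | inj₁ (_ , refl , N<N) = <-irrefl refl N<N
    ... | inj₂ (_ , () , _)
    fresh⁻ : ∀ {z} → z ∈ window N → -[1+ N ] ≢ z
    fresh⁻ z∈ refl with window-bound N z∈
    ... | inj₁ (_ , () , _)
    ... | inj₂ (_ , refl , N<N) = <-irrefl refl N<N

m≤m² : ∀ m → m ≤ m * m
m≤m² zero    = z≤n
m≤m² (suc m) = m≤m*n (suc m) (suc m)

squares : Enumeration square
squares = record
  -- The window of `suc n` suffices because z² = n implies |z| ≤ n.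
  { fibre    = λ n → filter (λ z → square z ≟ n) (window (suc n))
  ; unique   = λ n → Unique.filter⁺ (λ z → square z ≟ n) (window-unique (suc n))
  ; sound    = λ {n} z∈ → proj₂ (∈-filter⁻ (λ z → square z ≟ n) {xs = window (suc n)} z∈)
  ; complete = λ z → ∈-filter⁺ (λ x → square x ≟ square z) (∈-window z (s≤s (m≤m² ℤ.∣ z ∣))) refl
  }

φ : ℕ → ℤ
φ = count squares

open PowerSeries ℤ.+-*-commutativeRing
  using (series; X; conv; one; conv-cong; _≈[_]_; conv-cong-[]; conv-raise; 1+z-cancelˡ; X-conv-suc)
open FiniteGauss series using (y[_^_]; e; T; e-neg; W; finite-gauss)
module S = CommutativeRing series
open S using () renaming (_+_ to _⊕_; _*_ to _⊛_; _≈_ to _≋_)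
open import Algebra.Properties.Semiring.Exp S.semiring using () renaming (_^_ to _^ˢ_)
open import Algebra.Properties.Ring S.ring using (-‿distribˡ-*)

-- At q = −X the signs cancel: (−1)ⁿ q^(n²) = X^(n²).
q : ℕ → ℤ
q = S.- X

indicator : ℕ → ℕ → ℕ
indicator k n = if k ≡ᵇ n then 1 else 0

X^-coefficient : ∀ k n → (X ^ˢ k) n ≡ + indicator k n
X^-coefficient zero    zero    = refl
X^-coefficient zero    (suc n) = refl
X^-coefficient (suc k) zero    = refl
X^-coefficient (suc k) (suc n) = trans (X-conv-suc (X ^ˢ k) n) (X^-coefficient k n)

e-coefficient : ∀ k n → e q k n ≡ + indicator (k * k) n
e-coefficient k n = trans (e-neg X k n) (X^-coefficient (k * k) n)

filter-square-∷ : ∀ z zs n → length (filter (λ z → square z ≟ n) (z ∷ zs)) ≡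
                             indicator (square z) n + length (filter (λ z → square z ≟ n) zs)
filter-square-∷ z zs n with square z ≡ᵇ n
... | true  = refl
... | false = refl

T-coefficient : ∀ N n → T q N n ≡ + length (filter (λ z → square z ≟ n) (window N))
T-coefficient zero    n = refl
T-coefficient (suc N) n = begin
  T q N n ℤ.+ (e q N n ℤ.+ e q (suc N) n)
    ≡⟨ cong₂ ℤ._+_ (T-coefficient N n) (cong₂ ℤ._+_ (e-coefficient N n) (e-coefficient (suc N) n)) ⟩
  + (l + (a + b))
    ≡⟨ cong +_ (trans (+-comm l (a + b)) (+-assoc a b l)) ⟩
  + (a + (b + l))
    ≡⟨ cong (λ k → + (a + k)) (filter-square-∷ -[1+ N ] (window N) n) ⟨
  + (a + length (filter (λ z → square z ≟ n) (-[1+ N ] ∷ window N)))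
    ≡⟨ cong +_ (filter-square-∷ (+ N) (-[1+ N ] ∷ window N) n) ⟨
  + length (filter (λ z → square z ≟ n) (window (suc N))) ∎
  where
  open ≡-Reasoning
  l = length (filter (λ z → square z ≟ n) (window N))
  a = indicator (N * N) n
  b = indicator (suc N * suc N) n

indicator-< : ∀ {k n} → n < k → indicator k n ≡ 0
indicator-< {suc k} {zero}  _         = refl
indicator-< {suc k} {suc n} (s≤s n<k) = indicator-< n<k

e-vanish : ∀ {k i} → i < k → e q k i ≡ 0ℤ
e-vanish {k} {i} i<k = trans (e-coefficient k i) (cong +_ (indicator-< (<-≤-trans i<k (m≤m² k))))

-- The terms added to `T` after stage N start in degree at least N² ≥ N, so lower coefficients are
-- already final.
φ≈T : ∀ N → φ ≈[ N ] T q N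
φ≈T (suc N) i (s≤s i≤N) with m≤n⇒m<n∨m≡n i≤N
... | inj₂ refl = sym (T-coefficient (suc N) N)
... | inj₁ i<N  = begin
  φ i                                      ≡⟨ φ≈T N i i<N ⟩
  T q N i                                  ≡⟨ ℤ.+-identityʳ (T q N i) ⟨
  T q N i ℤ.+ 0ℤ                           ≡⟨ cong (ℤ._+_ (T q N i)) (cong₂ ℤ._+_ (e-vanish i<N) (e-vanish (m<n⇒m<1+n i<N))) ⟨
  T q N i ℤ.+ (e q N i ℤ.+ e q (suc N) i)  ∎
  where open ≡-Reasoning

sgn : ℕ → ℤ
sgn zero    = 1ℤ
sgn (suc n) = ℤ.- sgn n

-- The substitution of -X for X.
twist : (ℕ → ℤ) → ℕ → ℤ
twist f n = sgn n ℤ.* f n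

q-conv-suc : ∀ f n → (q ⊛ f) (suc n) ≡ ℤ.- f n
q-conv-suc f n = trans (sym (-‿distribˡ-* X f (suc n))) (cong ℤ.-_ (X-conv-suc f n))

-- Each factor q = -X shifts by one place and supplies the sign of that place.
q^-conv-twist : ∀ k f n → ((q ^ˢ k) ⊛ twist f) n ≡ twist (delay 0ℤ k f) n
q^-conv-twist zero    f n       = S.*-identityˡ (twist f) n
q^-conv-twist (suc k) f zero    = S.*-assoc q (q ^ˢ k) (twist f) 0
q^-conv-twist (suc k) f (suc n) = begin
  (q ⊛ (q ^ˢ k) ⊛ twist f) (suc n)          ≡⟨ S.*-assoc q (q ^ˢ k) (twist f) (suc n) ⟩
  (q ⊛ ((q ^ˢ k) ⊛ twist f)) (suc n)        ≡⟨ q-conv-suc _ n ⟩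
  ℤ.- ((q ^ˢ k) ⊛ twist f) n                ≡⟨ cong ℤ.-_ (q^-conv-twist k f n) ⟩
  ℤ.- (sgn n ℤ.* delay 0ℤ k f n)           ≡⟨ ℤ.neg-distribˡ-* (sgn n) (delay 0ℤ k f n) ⟩
  twist (delay 0ℤ (suc k) f) (suc n)       ∎
  where open ≡-Reasoning

delay-+ : ∀ k (f g : ℕ → ℤ) n → delay 0ℤ k (λ n → f n ℤ.+ g n) n ≡ delay 0ℤ k f n ℤ.+ delay 0ℤ k g n
delay-+ zero    f g n       = refl
delay-+ (suc k) f g zero    = refl
delay-+ (suc k) f g (suc n) = delay-+ k f g n

delay-cong : ∀ k {f g : ℕ → ℤ} → (∀ n → f n ≡ g n) → ∀ n → delay 0ℤ k f n ≡ delay 0ℤ k g n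
delay-cong zero    f≡g n       = f≡g n
delay-cong (suc k) f≡g zero    = refl
delay-cong (suc k) f≡g (suc n) = delay-cong k f≡g n

delay-length : {A : Set} → ∀ k (L : ℕ → List A) n → + length (delay [] k L n) ≡ delay 0ℤ k (λ n → + length (L n)) n
delay-length zero    L n       = refl
delay-length (suc k) L zero    = refl
delay-length (suc k) L (suc n) = delay-length k L n

F : ℕ → ℕ → ℤ
F s = twist (λ n → + length (bounded s n))

-- Eliminates the counts c of `following` from o′ = c + D c and c = o + D c: adding gives o′ + o = 2
-- c, so D (o′ + o) = 2 D c = o′ - o.
F-rec : ∀ s → F (suc s) ≋ F s ⊕ (q ^ˢ suc s) ⊛ (F (suc s) ⊕ F s)
F-rec s n = begin
  sgn n ℤ.* o′ n
    ≡⟨ cong (sgn n ℤ.*_) main ⟩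
  sgn n ℤ.* (o n ℤ.+ D (λ n → o′ n ℤ.+ o n) n)
    ≡⟨ ℤ.*-distribˡ-+ (sgn n) (o n) _ ⟩
  F s n ℤ.+ twist (D (λ n → o′ n ℤ.+ o n)) n
    ≡⟨ cong (ℤ._+_ (F s n)) (q^-conv-twist (suc s) _ n) ⟨
  F s n ℤ.+ ((q ^ˢ suc s) ⊛ twist (λ n → o′ n ℤ.+ o n)) n
    ≡⟨ cong (ℤ._+_ (F s n)) (S.*-congˡ {q ^ˢ suc s} (λ n → ℤ.*-distribˡ-+ (sgn n) (o′ n) (o n)) n) ⟩
  F s n ℤ.+ ((q ^ˢ suc s) ⊛ (F (suc s) ⊕ F s)) n ∎
  where
  open ≡-Reasoning
  o o′ c : ℕ → ℤ
  o  n = + length (bounded s n)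
  o′ n = + length (bounded (suc s) n)
  c  n = + length (following (suc s) n)
  D = delay 0ℤ (suc s)
  o′≡ : ∀ n → o′ n ≡ c n ℤ.+ D c n
  o′≡ n = trans (cong +_ (bounded-suc s n)) (cong (ℤ._+_ (c n)) (delay-length (suc s) (following (suc s)) n))
  c≡ : ∀ n → c n ≡ o n ℤ.+ D c n
  c≡ n = trans (cong +_ (following-suc s n)) (cong (ℤ._+_ (o n)) (delay-length (suc s) (following (suc s)) n))
  Do′+Do : D (λ n → o′ n ℤ.+ o n) n ≡ D c n ℤ.+ D c n
  Do′+Do = begin
    D (λ n → o′ n ℤ.+ o n) n
      ≡⟨ delay-cong (suc s) (λ n → trans (cong (ℤ._+ o n) (o′≡ n))
           (trans (ℤ.+-assoc (c n) (D c n) (o n)) (cong (ℤ._+_ (c n)) (trans (ℤ.+-comm (D c n) (o n)) (sym (c≡ n)))))) n ⟩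
    D (λ n → c n ℤ.+ c n) n
      ≡⟨ delay-+ (suc s) c c n ⟩
    D c n ℤ.+ D c n ∎
  main : o′ n ≡ o n ℤ.+ D (λ n → o′ n ℤ.+ o n) n
  main = begin
    o′ n                              ≡⟨ o′≡ n ⟩
    c n ℤ.+ D c n                     ≡⟨ cong (ℤ._+ D c n) (c≡ n) ⟩
    o n ℤ.+ D c n ℤ.+ D c n           ≡⟨ ℤ.+-assoc (o n) (D c n) (D c n) ⟩
    o n ℤ.+ (D c n ℤ.+ D c n)         ≡⟨ cong (ℤ._+_ (o n)) Do′+Do ⟨
    o n ℤ.+ D (λ n → o′ n ℤ.+ o n) n  ∎

A : ℕ → ℤ
A = twist (λ n → + p̄ n)

A≈F : ∀ N → A ≈[ N ] F N
A≈F N i i<N = cong (λ k → sgn i ℤ.* + k) (sym (bounded-all (<⇒≤ i<N)))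

F₀≋1 : F 0 ≋ one
F₀≋1 zero    = refl
F₀≋1 (suc n) = trans (cong (λ k → sgn (suc n) ℤ.* + k) (bounded-zero-suc n)) (ℤ.*-zeroʳ (sgn (suc n)))

q^-conv-small : ∀ N f → (q ^ˢ N) ⊛ f ≈[ N ] λ _ → 0ℤ
q^-conv-small (suc N) f i i<1+N = begin
  (q ⊛ (q ^ˢ N) ⊛ f) i   ≡⟨ S.*-assoc q (q ^ˢ N) f i ⟩
  (q ⊛ ((q ^ˢ N) ⊛ f)) i ≡⟨ conv-raise {q} refl (q^-conv-small N f) i i<1+N ⟩
  (q ⊛ (λ _ → 0ℤ)) i    ≡⟨ S.zeroʳ q i ⟩
  0ℤ                    ∎
  where open ≡-Reasoning

y-conv-small : ∀ N f → y[ q ^ N ] ⊛ f ≈[ N ] λ _ → 0ℤ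
y-conv-small N f i i<N = trans (sym (-‿distribˡ-* (q ^ˢ N) f i)) (cong ℤ.-_ (q^-conv-small N f i i<N))

-- Every term after the first contains y = -q^N, which vanishes below degree N; the first term is F
-- 0 = 1.
W≈1 : ∀ m N → W F (suc m) y[ q ^ N ] ≈[ N ] one
W≈1 zero    N i i<N = trans (ℤ.+-identityˡ _) (trans (S.*-identityˡ (F 0) i) (F₀≋1 i))
W≈1 (suc m) N i i<N = trans (cong₂ ℤ._+_ (W≈1 m N i i<N)
  (trans (S.*-assoc y[ q ^ N ] (y[ q ^ N ] ^ˢ m) (F (suc m)) i) (y-conv-small N _ i i<N)))
  (ℤ.+-identityʳ (one i))

-- The coefficient at n is read off from `finite-gauss` at stage n + 1, where A and φ may be
-- replaced by their finite forms, the extra term with y vanishes and the right-hand side is 1.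
A⊛φ≋1 : A ⊛ φ ≋ one
A⊛φ≋1 n = begin
  (A ⊛ φ) n           ≡⟨ conv-cong-[] (A≈F N) (φ≈T N) n (n<1+n n) ⟩
  (F N ⊛ T q N) n     ≡⟨ ℤ.+-identityʳ _ ⟨
  (F N ⊛ T q N) n ℤ.+ 0ℤ
    ≡⟨ cong (ℤ._+_ ((F N ⊛ T q N) n)) (y-conv-small N _ n (n<1+n n)) ⟨
  (F N ⊛ T q N) n ℤ.+ (y[ q ^ N ] ⊛ W F N y[ q ^ N ]) n
    ≡⟨ finite-gauss q F F-rec cancel N n ⟩
  W F N y[ q ^ N ] n
    ≡⟨ W≈1 n N n (n<1+n n) ⟩
  one n ∎
  where
  open ≡-Reasoning
  N = suc n
  cancel : ∀ n {a b} → (one ⊕ y[ q ^ suc n ]) ⊛ a ≋ (one ⊕ y[ q ^ suc n ]) ⊛ b → a ≋ b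
  cancel n {a} {b} eq = 1+z-cancelˡ {y[ q ^ suc n ]} refl (λ i →
    trans (sym (expand a i)) (trans (eq i) (expand b i)))
    where
    expand : ∀ a → (one ⊕ y[ q ^ suc n ]) ⊛ a ≋ a ⊕ y[ q ^ suc n ] ⊛ a
    expand a i = trans (S.distribʳ a one y[ q ^ suc n ] i)
                       (cong (ℤ._+ (y[ q ^ suc n ] ⊛ a) i) (S.*-identityˡ a i))

-- Sums of two and three squares

private
  Σ² : ℕ → ℕ → ℕ → ℕ
  Σ² x y z = x * x + y * y + z * z

  -- Since (r + 4 x)² = r² + 8 (r x + 2 x²), a square modulo 8 depends only on its root modulo 4,
  -- and 64 cases are checked by computation.
  residues-mod-4 : ∀ (r s t : Fin 4) → Σ² (toℕ r) (toℕ s) (toℕ t) % 8 ≢ 7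
  residues-mod-4 = from-yes (all? {4} λ r → all? {4} λ s → all? {4} λ t → ¬? (Σ² (toℕ r) (toℕ s) (toℕ t) % 8 ≟ 7))

  Σ²≢8k+7 : ∀ k x y z → Σ² x y z ≢ 8 * k + 7
  Σ²≢8k+7 k x y z eq with x divMod 4 | y divMod 4 | z divMod 4
  ... | result x′ r refl | result y′ s refl | result z′ t refl = residues-mod-4 r s t (begin
    R % 8            ≡⟨ [m+kn]%n≡m%n R M 8 ⟨
    (R + M * 8) % 8  ≡⟨ cong (_% 8) (trans (sym expand) eq) ⟩
    (8 * k + 7) % 8  ≡⟨ cong (_% 8) (trans (+-comm (8 * k) 7) (cong (λ t → 7 + t) (*-comm 8 k))) ⟩
    (7 + k * 8) % 8  ≡⟨ [m+kn]%n≡m%n 7 k 8 ⟩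
    7                ∎)
    where
    open ≡-Reasoning
    R = Σ² (toℕ r) (toℕ s) (toℕ t)
    M = (toℕ r * x′ + 2 * (x′ * x′)) + (toℕ s * y′ + 2 * (y′ * y′)) + (toℕ t * z′ + 2 * (z′ * z′))
    open ℕ-Solver
    expand : Σ² (toℕ r + x′ * 4) (toℕ s + y′ * 4) (toℕ t + z′ * 4) ≡ R + M * 8
    expand = solve 6 (λ r x s y t z →
      (r :+ x :* con 4) :* (r :+ x :* con 4) :+ (s :+ y :* con 4) :* (s :+ y :* con 4) :+ (t :+ z :* con 4) :* (t :+ z :* con 4) :=
      (r :* r :+ s :* s :+ t :* t) :+
      ((r :* x :+ con 2 :* (x :* x)) :+ (s :* y :+ con 2 :* (y :* y)) :+ (t :* z :+ con 2 :* (z :* z))) :* con 8)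
      refl (toℕ r) x′ (toℕ s) y′ (toℕ t) z′

  -- Squares are 0 or 1 modulo 4, so three of them sum to a multiple of 4 only if all roots are
  -- even.
  residues-mod-2 : ∀ (r s t : Fin 2) → Σ² (toℕ r) (toℕ s) (toℕ t) % 4 ≡ 0 →
                   r ≡ Fin.zero × s ≡ Fin.zero × t ≡ Fin.zero
  residues-mod-2 = from-yes (all? {2} λ r → all? {2} λ s → all? {2} λ t →
    (Σ² (toℕ r) (toℕ s) (toℕ t) % 4 ≟ 0) →-dec ((r Fin.≟ Fin.zero) ×-dec (s Fin.≟ Fin.zero) ×-dec (t Fin.≟ Fin.zero)))

  Σ²-halve : ∀ K r s t x y z → Σ² (toℕ {2} r + x * 2) (toℕ {2} s + y * 2) (toℕ {2} t + z * 2) ≡ K * 4 →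
             Σ² x y z ≡ K
  Σ²-halve K r s t x y z eq with residues-mod-2 r s t R%4≡0
    where
    open ≡-Reasoning
    open ℕ-Solver
    R = Σ² (toℕ r) (toℕ s) (toℕ t)
    M = (toℕ r * x + x * x) + (toℕ s * y + y * y) + (toℕ t * z + z * z)
    expand : Σ² (toℕ r + x * 2) (toℕ s + y * 2) (toℕ t + z * 2) ≡ R + M * 4
    expand = solve 6 (λ r x s y t z →
      (r :+ x :* con 2) :* (r :+ x :* con 2) :+ (s :+ y :* con 2) :* (s :+ y :* con 2) :+ (t :+ z :* con 2) :* (t :+ z :* con 2) :=
      (r :* r :+ s :* s :+ t :* t) :+ ((r :* x :+ x :* x) :+ (s :* y :+ y :* y) :+ (t :* z :+ z :* z)) :* con 4)
      refl (toℕ r) x (toℕ s) y (toℕ t) z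
    R%4≡0 : R % 4 ≡ 0
    R%4≡0 = begin
      R % 4            ≡⟨ [m+kn]%n≡m%n R M 4 ⟨
      (R + M * 4) % 4  ≡⟨ cong (_% 4) (trans (sym expand) eq) ⟩
      (K * 4) % 4      ≡⟨ m*n%n≡0 K 4 ⟩
      0                ∎
  ... | refl , refl , refl = *-cancelʳ-≡ _ _ 4 (trans expand₀ eq)
    where
    open ℕ-Solver
    expand₀ : Σ² x y z * 4 ≡ Σ² (x * 2) (y * 2) (z * 2)
    expand₀ = solve 3 (λ x y z → (x :* x :+ y :* y :+ z :* z) :* con 4 :=
      (x :* con 2) :* (x :* con 2) :+ (y :* con 2) :* (y :* con 2) :+ (z :* con 2) :* (z :* con 2)) refl x y z

-- Descent on α: a factor 4 forces even roots, and halving them removes it.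
three-squares≢ : ∀ α k x y z → x * x + y * y + z * z ≢ 4 ^ α * (8 * k + 7)
three-squares≢ zero    k x y z eq = Σ²≢8k+7 k x y z (trans eq (*-identityˡ _))
three-squares≢ (suc α) k x y z eq with x divMod 2 | y divMod 2 | z divMod 2
... | result x′ r refl | result y′ s refl | result z′ t refl =
  three-squares≢ α k x′ y′ z′ (Σ²-halve _ r s t x′ y′ z′
    (trans eq (trans (*-assoc 4 (4 ^ α) (8 * k + 7)) (*-comm 4 (4 ^ α * (8 * k + 7))))))

-- Adding the square of 2^(α+1), which is 4 · 4^α, would give three squares with sum 4^α (8 m + 7).
two-squares≢ : ∀ α m x y → x * x + y * y ≢ 4 ^ α * (8 * m + 3)
two-squares≢ α m x y eq = three-squares≢ α m x y (2 ^ suc α) (begin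
  x * x + y * y + 2 ^ suc α * 2 ^ suc α  ≡⟨ cong₂ _+_ eq 2ˢ2ˢ≡4ˢ ⟩
  4 ^ α * (8 * m + 3) + 4 ^ suc α        ≡⟨ solve 2 (λ p m → p :* (con 8 :* m :+ con 3) :+ con 4 :* p := p :* (con 8 :* m :+ con 7))
                                              refl (4 ^ α) m ⟩
  4 ^ α * (8 * m + 7)                    ∎)
  where
  open ≡-Reasoning
  open ℕ-Solver
  2ˢ2ˢ≡4ˢ : 2 ^ suc α * 2 ^ suc α ≡ 4 ^ suc α
  2ˢ2ˢ≡4ˢ = trans (sym (^-distribˡ-+-* 2 (suc α) (suc α)))
    (trans (cong (λ s → 2 ^ (suc α + s)) (sym (+-identityʳ (suc α)))) (sym (^-*-assoc 2 2 (suc α))))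

-- Powers of φ count representations as sums of squares

module _ {A B : Set} where

  -- Follows the recursion of `conv`, so that taking lengths yields the Cauchy product term by term.
  pairs : (ℕ → List A) → (ℕ → List B) → ℕ → List (A × B)
  pairs L M zero    = cartesianProduct (L 0) (M 0)
  pairs L M (suc n) = cartesianProduct (L 0) (M (suc n)) ++ pairs (L ∘ suc) M n

  ∈-pairs⁺ : ∀ {x y} L M i j → x ∈ L i → y ∈ M j → (x , y) ∈ pairs L M (i + j)
  ∈-pairs⁺ L M zero    zero    x∈ y∈ = ∈-cartesianProduct⁺ x∈ y∈
  ∈-pairs⁺ L M zero    (suc j) x∈ y∈ = ∈-++⁺ˡ (∈-cartesianProduct⁺ x∈ y∈)
  ∈-pairs⁺ L M (suc i) j       x∈ y∈ =
    ∈-++⁺ʳ (cartesianProduct (L 0) (M (suc i + j))) (∈-pairs⁺ (L ∘ suc) M i j x∈ y∈)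

  ∈-pairs⁻ : ∀ {x y} L M n → (x , y) ∈ pairs L M n →
             ∃₂ λ i j → i + j ≡ n × x ∈ L i × y ∈ M j
  ∈-pairs⁻ L M zero    xy∈ = 0 , 0 , refl , ∈-cartesianProduct⁻ (L 0) (M 0) xy∈
  ∈-pairs⁻ L M (suc n) xy∈ with ∈-++⁻ (cartesianProduct (L 0) (M (suc n))) xy∈
  ... | inj₁ xy∈₀ = 0 , suc n , refl , ∈-cartesianProduct⁻ (L 0) (M (suc n)) xy∈₀
  ... | inj₂ xy∈′ with i , j , i+j≡n , x∈y∈ ← ∈-pairs⁻ (L ∘ suc) M n xy∈′ = suc i , j , cong suc i+j≡n , x∈y∈

  pairs-unique : ∀ L M → (∀ {x i j} → x ∈ L i → x ∈ L j → i ≡ j) →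
                 (∀ i → Unique (L i)) → (∀ j → Unique (M j)) → ∀ n → Unique (pairs L M n)
  pairs-unique L M L-disjoint uL uM zero    = Unique.cartesianProduct⁺ (uL 0) (uM 0)
  pairs-unique L M L-disjoint uL uM (suc n) =
    Unique.++⁺ (Unique.cartesianProduct⁺ (uL 0) (uM (suc n)))
               (pairs-unique (L ∘ suc) M (λ x∈ x∈′ → suc-injective (L-disjoint x∈ x∈′)) (uL ∘ suc) uM n)
               disjoint
    where
    disjoint : Disjoint (cartesianProduct (L 0) (M (suc n))) (pairs (L ∘ suc) M n)
    disjoint (xy∈₀ , xy∈′)
      with x∈₀ , _ ← ∈-cartesianProduct⁻ (L 0) (M (suc n)) xy∈₀
         | _ , _ , _ , x∈′ , _ ← ∈-pairs⁻ (L ∘ suc) M n xy∈′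
      with () ← L-disjoint x∈₀ x∈′

  length-cartesianProduct : ∀ (xs : List A) (ys : List B) →
                            length (cartesianProduct xs ys) ≡ length xs * length ys
  length-cartesianProduct []       ys = refl
  length-cartesianProduct (x ∷ xs) ys =
    trans (length-++ (map (x ,_) ys)) (cong₂ _+_ (length-map (x ,_) ys) (length-cartesianProduct xs ys))

  length-pairs : ∀ (L : ℕ → List A) (M : ℕ → List B) n →
                 + length (pairs L M n) ≡ conv (λ i → + length (L i)) (λ j → + length (M j)) n
  length-pairs L M zero    = trans (cong +_ (length-cartesianProduct (L 0) (M 0))) (ℤ.pos-* (length (L 0)) (length (M 0)))
  length-pairs L M (suc n) = begin
    + length (cartesianProduct (L 0) (M (suc n)) ++ pairs (L ∘ suc) M n)
      ≡⟨ cong +_ (length-++ (cartesianProduct (L 0) (M (suc n)))) ⟩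
    + length (cartesianProduct (L 0) (M (suc n))) ℤ.+ + length (pairs (L ∘ suc) M n)
      ≡⟨ cong₂ ℤ._+_ (trans (cong +_ (length-cartesianProduct (L 0) (M (suc n)))) (ℤ.pos-* (length (L 0)) (length (M (suc n)))))
                     (length-pairs (L ∘ suc) M n) ⟩
    conv (λ i → + length (L i)) (λ j → + length (M j)) (suc n) ∎
    where open ≡-Reasoning

  infixr 7 _⊗_
  _⊗_ : {w : A → ℕ} {v : B → ℕ} → Enumeration w → Enumeration v →
        Enumeration (λ xy → w (proj₁ xy) + v (proj₂ xy))
  _⊗_ {w} {v} E E′ = record
    { fibre    = pairs (fibre E) (fibre E′)
    ; unique   = pairs-unique (fibre E) (fibre E′) (λ x∈ x∈′ → trans (sym (sound E x∈)) (sound E x∈′)) (unique E) (unique E′)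
    ; sound    = sound′
    ; complete = λ (x , y) → ∈-pairs⁺ (fibre E) (fibre E′) (w x) (v y) (complete E x) (complete E′ y)
    }
    where
    sound′ : ∀ {n xy} → xy ∈ pairs (fibre E) (fibre E′) n → w (proj₁ xy) + v (proj₂ xy) ≡ n
    sound′ {n} xy∈ with i , j , i+j≡n , x∈ , y∈ ← ∈-pairs⁻ (fibre E) (fibre E′) n xy∈ =
      trans (cong₂ _+_ (sound E x∈) (sound E′ y∈)) i+j≡n

  count-⊗ : {w : A → ℕ} {v : B → ℕ} (E : Enumeration w) (E′ : Enumeration v) →
            count (E ⊗ E′) ≋ count E ⊛ count E′
  count-⊗ E E′ = length-pairs (fibre E) (fibre E′)

count-empty : {A : Set} {w : A → ℕ} (E : Enumeration w) → ∀ {n} → (∀ x → w x ≢ n) → count E n ≡ 0ℤ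
count-empty E {n} w≢n with fibre E n in eq
... | []    = refl
... | x ∷ _ = contradiction (sound E (subst (x ∈_) (sym eq) (here refl))) (w≢n x)

φ²-zero : ∀ α m → (φ ⊛ φ) (4 ^ α * (8 * m + 3)) ≡ 0ℤ
φ²-zero α m = trans (sym (count-⊗ squares squares (4 ^ α * (8 * m + 3))))
  (count-empty (squares ⊗ squares) λ (x , y) → two-squares≢ α m (ℤ.∣ x ∣) (ℤ.∣ y ∣))

φ-zero : ∀ α m → φ (4 ^ α * (8 * m + 3)) ≡ 0ℤ
φ-zero α m = count-empty squares λ x eq → two-squares≢ α m (ℤ.∣ x ∣) 0 (trans (+-identityʳ _) eq)

count-φ³ : count (squares ⊗ squares ⊗ squares) ≋ φ ⊛ (φ ⊛ φ)
count-φ³ n = trans (count-⊗ squares (squares ⊗ squares) n) (conv-cong {φ} (λ _ → refl) (count-⊗ squares squares) n)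

φ³-zero : ∀ α k → (φ ⊛ (φ ⊛ φ)) (4 ^ α * (8 * k + 7)) ≡ 0ℤ
φ³-zero α k = trans (sym (count-φ³ (4 ^ α * (8 * k + 7))))
  (count-empty (squares ⊗ squares ⊗ squares) λ (x , y , z) eq →
    three-squares≢ α k ℤ.∣ x ∣ ℤ.∣ y ∣ ℤ.∣ z ∣ (trans (+-assoc (square x) (square y) (square z)) eq))

-- Divisibility by 8

*-pres-∣ : ∀ {a b x y} → a ∣ℤ x → b ∣ℤ y → a ℤ.* b ∣ℤ x ℤ.* y
*-pres-∣ {a} {b} (ℤ∣.divides k refl) (ℤ∣.divides l refl) = ℤ∣.divides (k ℤ.* l)
  (solve 4 (λ a b k l → (k :* a) :* (l :* b) := (k :* l) :* (a :* b)) refl a b k l)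
  where open ℤ-Solver

conv-pres-∣ : ∀ {a b f g} → (∀ n → a ∣ℤ f n) → (∀ n → b ∣ℤ g n) → ∀ n → a ℤ.* b ∣ℤ conv f g n
conv-pres-∣ a∣f b∣g zero    = *-pres-∣ (a∣f 0) (b∣g 0)
conv-pres-∣ a∣f b∣g (suc n) = ℤ∣.∣m∣n⇒∣m+n (*-pres-∣ (a∣f 0) (b∣g (suc n))) (conv-pres-∣ (a∣f ∘ suc) b∣g n)

φ-1 : ℕ → ℤ
φ-1 n = φ n ℤ.- one n

-- Apart from 0, the integers j and -j pair up. Adding `e q N` to `T q N` completes the range to -N,
-- ..., N, which makes the pairing exact; at N = n + 1 the added term vanishes in degree n.
2∣φ-1 : ∀ n → + 2 ∣ℤ φ-1 n
2∣φ-1 n = subst (λ t → + 2 ∣ℤ t ℤ.- one n)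
  (trans (cong₂ ℤ._+_ (T-coefficient (suc n) n) (e-vanish (n<1+n n))) (ℤ.+-identityʳ (φ n)))
  (partial (suc n))
  where
  open ℤ-Solver
  partial : ∀ N → + 2 ∣ℤ (T q N n ℤ.+ e q N n) ℤ.- one n
  partial zero    = ℤ∣.divides 0ℤ (solve 1 (λ x → (con 0ℤ :+ x) :- x := con 0ℤ) refl (one n))
  partial (suc N) = subst (+ 2 ∣ℤ_)
    (solve 4 (λ t e e′ o → ((t :+ e) :- o) :+ e′ :* con (+ 2) := ((t :+ (e :+ e′)) :+ e′) :- o)
       refl (T q N n) (e q N n) (e q (suc N) n) (one n))
    (ℤ∣.∣m∣n⇒∣m+n (partial N) (ℤ∣.divides (e q (suc N) n) refl))

-- With ψ = φ − 1 the identity A φ = 1 gives A = 1 − ψ + ψ² − A ψ³, and 8 divides ψ³.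
8∣A : ∀ n → one n ≡ 0ℤ → φ n ≡ 0ℤ → (φ ⊛ φ) n ≡ 0ℤ → + 8 ∣ℤ A n
8∣A n 1ₙ φₙ φ²ₙ = subst (+ 8 ∣ℤ_) A≡ (ℤ∣.∣m⇒∣-m 8∣Aψ³)
  where
  open ℤ-Solver
  ψ = φ-1
  φ≋ : φ ≋ one ⊕ ψ
  φ≋ n = solve 2 (λ f o → f := o :+ (f :- o)) refl (φ n) (one n)
  expand : ∀ f → f ⊛ φ ≋ f ⊕ f ⊛ ψ
  expand f = S.trans (S.*-congˡ {f} φ≋) (S.trans (S.distribˡ f one ψ) (S.+-congʳ {f ⊛ ψ} (S.*-identityʳ f)))
  Aψ : A ⊕ A ⊛ ψ ≋ one
  Aψ = S.trans (S.sym (expand A)) A⊛φ≋1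
  Aψ² : ψ ≋ (A ⊛ ψ) ⊕ (A ⊛ ψ ⊛ ψ)
  Aψ² = S.trans (S.sym (S.*-identityˡ ψ)) (S.trans (S.*-congʳ {ψ} (S.sym Aψ)) (S.distribʳ ψ A (A ⊛ ψ)))
  Aψ³ : ψ ⊛ ψ ≋ (A ⊛ ψ ⊛ ψ) ⊕ (A ⊛ ψ ⊛ ψ ⊛ ψ)
  Aψ³ = S.trans (S.*-congʳ {ψ} Aψ²) (S.distribʳ ψ (A ⊛ ψ) (A ⊛ ψ ⊛ ψ))
  φ²≋ : φ ⊛ φ ≋ φ ⊕ (ψ ⊕ ψ ⊛ ψ)
  φ²≋ = S.trans (expand φ) (S.+-congˡ {φ} (S.trans (S.*-comm φ ψ) (expand ψ)))
  ψₙ : ψ n ≡ 0ℤ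
  ψₙ = cong₂ ℤ._-_ φₙ 1ₙ
  ψ²ₙ : (ψ ⊛ ψ) n ≡ 0ℤ
  ψ²ₙ = begin
    (ψ ⊛ ψ) n                     ≡⟨ ℤ.+-identityˡ _ ⟨
    0ℤ ℤ.+ (ψ ⊛ ψ) n              ≡⟨ ℤ.+-identityˡ _ ⟨
    0ℤ ℤ.+ (0ℤ ℤ.+ (ψ ⊛ ψ) n)     ≡⟨ cong₂ (λ a b → a ℤ.+ (b ℤ.+ (ψ ⊛ ψ) n)) φₙ ψₙ ⟨
    φ n ℤ.+ (ψ n ℤ.+ (ψ ⊛ ψ) n)   ≡⟨ φ²≋ n ⟨
    (φ ⊛ φ) n                     ≡⟨ φ²ₙ ⟩
    0ℤ                            ∎
    where open ≡-Reasoning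
  8∣Aψ³ : + 8 ∣ℤ (A ⊛ ψ ⊛ ψ ⊛ ψ) n
  8∣Aψ³ = conv-pres-∣ {+ 4} {+ 2} {A ⊛ ψ ⊛ ψ} (conv-pres-∣ {+ 2} {+ 2} {A ⊛ ψ} (conv-pres-∣ {+ 1} {+ 2} {A}
    (λ n → ℤ∣.divides (A n) (sym (ℤ.*-identityʳ (A n)))) 2∣φ-1) 2∣φ-1) 2∣φ-1 n
  -- The bracketed sums are the coefficients at n of 1, ψ and ψ², all of them zero.
  A≡ : ℤ.- (A ⊛ ψ ⊛ ψ ⊛ ψ) n ≡ A n
  A≡ = begin
    ℤ.- a₃
      ≡⟨ solve 4 (λ a a₁ a₂ a₃ → :- a₃ := a :- (a :+ a₁) :+ (a₁ :+ a₂) :- (a₂ :+ a₃)) refl a a₁ a₂ a₃ ⟩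
    a ℤ.- (a ℤ.+ a₁) ℤ.+ (a₁ ℤ.+ a₂) ℤ.- (a₂ ℤ.+ a₃)
      ≡⟨ cong₂ ℤ._-_ (cong₂ (λ u v → a ℤ.- u ℤ.+ v) (trans (Aψ n) 1ₙ) (trans (sym (Aψ² n)) ψₙ)) (trans (sym (Aψ³ n)) ψ²ₙ) ⟩
    a ℤ.- 0ℤ ℤ.+ 0ℤ ℤ.- 0ℤ
      ≡⟨ solve 1 (λ a → a :- con 0ℤ :+ con 0ℤ :- con 0ℤ := a) refl a ⟩
    a ∎
    where
    open ≡-Reasoning
    a = A n
    a₁ = (A ⊛ ψ) n
    a₂ = (A ⊛ ψ ⊛ ψ) n
    a₃ = (A ⊛ ψ ⊛ ψ ⊛ ψ) n

∣A∣≡p̄ : ∀ n → ℤ.∣ A n ∣ ≡ p̄ n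
∣A∣≡p̄ n = trans (ℤ.abs-* (sgn n) (+ p̄ n)) (trans (cong (_* p̄ n) (∣sgn∣≡1 n)) (*-identityˡ (p̄ n)))
  where
  ∣sgn∣≡1 : ∀ n → ℤ.∣ sgn n ∣ ≡ 1
  ∣sgn∣≡1 zero    = refl
  ∣sgn∣≡1 (suc n) = trans (ℤ.∣-i∣≡∣i∣ (sgn n)) (∣sgn∣≡1 n)

8∣p̄ : ∀ α m → 8 ∣ p̄ (4 ^ α * (8 * m + 3))
8∣p̄ α m = subst (8 ∣_) (∣A∣≡p̄ n) (ℤ∣.∣⇒∣ᵤ (8∣A n 1ₙ (φ-zero α m) (φ²-zero α m)))
  where
  n = 4 ^ α * (8 * m + 3)
  1ₙ : one n ≡ 0ℤ
  1ₙ with 4 ^ α * (8 * m + 3) in eq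
  -- The index is not 0, because 0 = 0² + 0² is a sum of two squares.
  ... | zero  = contradiction (sym eq) (two-squares≢ α m 0 0)
  ... | suc _ = refl

-- Integers modulo 5

infix 4 _≡_[mod_]
record _≡_[mod_] (i j : ℤ) (m : ℕ) : Set where
  constructor congruent
  field divides-difference : + m ∣ℤ i ℤ.- j
open _≡_[mod_] public

module _ (m : ℕ) where

  private
    reflexive : ∀ {i j} → i ≡ j → i ≡ j [mod m ]
    reflexive {i} refl = congruent (ℤ∣.divides 0ℤ (ℤ.+-inverseʳ i))

  -- Only the equality changes: the carrier remains ℤ, so integer series serve as series modulo m
  -- without conversion.
  ℤ-mod : CommutativeRing 0ℓ 0ℓ
  ℤ-mod = record
    { Carrier = ℤ ; _≈_ = _≡_[mod m ] ; _+_ = ℤ._+_ ; _*_ = ℤ._*_ ; -_ = ℤ.-_ ; 0# = 0ℤ ; 1# = 1ℤ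
    ; isCommutativeRing = record
      { isRing = record
        { +-isAbelianGroup = record
          { isGroup = record
            { isMonoid = record
              { isSemigroup = record
                { isMagma = record
                  { isEquivalence = record
                    { refl = reflexive refl
                    ; sym = λ {i} {j} (congruent d) → congruent (subst (+ m ∣ℤ_)
                        (solve 2 (λ i j → :- (i :- j) := j :- i) refl i j) (ℤ∣.∣m⇒∣-m d))
                    ; trans = λ {i} {j} {k} (congruent d) (congruent d′) → congruent (subst (+ m ∣ℤ_)
                        (solve 3 (λ i j k → (i :- j) :+ (j :- k) := i :- k) refl i j k) (ℤ∣.∣m∣n⇒∣m+n d d′))
                    }
                  ; ∙-cong = λ {i} {j} {k} {l} (congruent d) (congruent d′) → congruent (subst (+ m ∣ℤ_)
                      (solve 4 (λ i j k l → (i :- j) :+ (k :- l) := (i :+ k) :- (j :+ l)) refl i j k l) (ℤ∣.∣m∣n⇒∣m+n d d′))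
                  }
                ; assoc = λ i j k → reflexive (ℤ.+-assoc i j k)
                }
              ; identity = (λ i → reflexive (ℤ.+-identityˡ i)) , λ i → reflexive (ℤ.+-identityʳ i)
              }
            ; inverse = (λ i → reflexive (ℤ.+-inverseˡ i)) , λ i → reflexive (ℤ.+-inverseʳ i)
            ; ⁻¹-cong = λ {i} {j} (congruent d) → congruent (subst (+ m ∣ℤ_)
                (solve 2 (λ i j → :- (i :- j) := :- i :- :- j) refl i j) (ℤ∣.∣m⇒∣-m d))
            }
          ; comm = λ i j → reflexive (ℤ.+-comm i j)
          }
        ; *-cong = λ {i} {j} {k} {l} (congruent d) (congruent d′) → congruent (subst (+ m ∣ℤ_)
            (solve 4 (λ i j k l → (i :- j) :* k :+ j :* (k :- l) := (i :* k) :- (j :* l)) refl i j k l)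
            (ℤ∣.∣m∣n⇒∣m+n (ℤ∣.∣m⇒∣m*n k d) (ℤ∣.∣n⇒∣m*n j d′)))
        ; *-assoc = λ i j k → reflexive (ℤ.*-assoc i j k)
        ; *-identity = (λ i → reflexive (ℤ.*-identityˡ i)) , λ i → reflexive (ℤ.*-identityʳ i)
        ; distrib = (λ i j k → reflexive (ℤ.*-distribˡ-+ i j k)) , λ i j k → reflexive (ℤ.*-distribʳ-+ i j k)
        }
      ; *-comm = λ i j → reflexive (ℤ.*-comm i j)
      }
    }
    where open ℤ-Solver

residue₅ : ∀ x → ∃ λ (r : Fin 5) → x ≡ + toℕ r [mod 5 ]
residue₅ x = Fin.fromℕ< (ℤ.n%ℕd<d x 5) , congruent (ℤ∣.divides (x ℤ./ℕ 5) (begin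
  x ℤ.- + toℕ (Fin.fromℕ< (ℤ.n%ℕd<d x 5))
    ≡⟨ cong (λ r → x ℤ.- + r) (toℕ-fromℕ< (ℤ.n%ℕd<d x 5)) ⟩
  x ℤ.- + (x ℤ.%ℕ 5)
    ≡⟨ cong (λ y → y ℤ.- + (x ℤ.%ℕ 5)) (ℤ.a≡a%ℕn+[a/ℕn]*n x 5) ⟩
  + (x ℤ.%ℕ 5) ℤ.+ (x ℤ./ℕ 5) ℤ.* + 5 ℤ.- + (x ℤ.%ℕ 5)
    ≡⟨ solve 2 (λ r k → r :+ k :- r := k) refl (+ (x ℤ.%ℕ 5)) ((x ℤ./ℕ 5) ℤ.* + 5) ⟩
  (x ℤ./ℕ 5) ℤ.* + 5 ∎))
  where
  open ≡-Reasoning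
  open ℤ-Solver

ℤ₅ : CommutativeRing 0ℓ 0ℓ
ℤ₅ = ℤ-mod 5

private module ℤ₅ = CommutativeRing ℤ₅

open Frobenius₅ ℤ₅ using (_⁵; dilate; section-dilate; frobenius)

ℤ₅-char : ∀ x → (x ℤ.+ x ℤ.+ x ℤ.+ x ℤ.+ x) ≡ 0ℤ [mod 5 ]
ℤ₅-char x = congruent (ℤ∣.divides x (solve 1 (λ x → (x :+ x :+ x :+ x :+ x) :- con 0ℤ := x :* con (+ 5)) refl x))
  where open ℤ-Solver

ℤ₅-fermat : ∀ x → (x ⁵) ≡ x [mod 5 ]
ℤ₅-fermat x with r , x≈r ← residue₅ x =
  ℤ₅.trans (ℤ₅.*-cong (ℤ₅.*-cong (ℤ₅.*-cong (ℤ₅.*-cong x≈r x≈r) x≈r) x≈r) x≈r)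
           (ℤ₅.trans (check r) (ℤ₅.sym x≈r))
  where
  check : ∀ (r : Fin 5) → ((+ toℕ r) ⁵) ≡ + toℕ r [mod 5 ]
  check r = congruent (from-yes (all? {5} λ r → + 5 ℤ∣.∣? ((+ toℕ r) ⁵) ℤ.- + toℕ r) r)

-- Sums of four squares modulo 5

ℤ⁴ : Set
ℤ⁴ = ℤ × ℤ × ℤ × ℤ

norm : ℤ⁴ → ℕ
norm (a , b , c , d) = square a + (square b + (square c + square d))

+square : ∀ z → + square z ≡ z ℤ.* z
+square (+ n)    = ℤ.pos-* n n
+square -[1+ n ] = refl

+norm : ∀ a b c d → + norm (a , b , c , d) ≡ a ℤ.* a ℤ.+ (b ℤ.* b ℤ.+ (c ℤ.* c ℤ.+ d ℤ.* d))
+norm a b c d = cong₂ ℤ._+_ (+square a) (cong₂ ℤ._+_ (+square b) (cong₂ ℤ._+_ (+square c) (+square d)))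

-- Left multiplication of quaternions by 1 + 2i.
[1+2i]· : ℤ⁴ → ℤ⁴
[1+2i]· (a , b , c , d) = a ℤ.- + 2 ℤ.* b , b ℤ.+ + 2 ℤ.* a , c ℤ.- + 2 ℤ.* d , d ℤ.+ + 2 ℤ.* c

norm-[1+2i]· : ∀ y → norm ([1+2i]· y) ≡ norm y * 5
norm-[1+2i]· y@(a , b , c , d) = ℤ.+-injective (begin
  + norm ([1+2i]· y)
    ≡⟨ +norm (a ℤ.- + 2 ℤ.* b) (b ℤ.+ + 2 ℤ.* a) (c ℤ.- + 2 ℤ.* d) (d ℤ.+ + 2 ℤ.* c) ⟩
  _ ≡⟨ solve 4 (λ a b c d →
        let sq = λ x → x :* x
            two = con (+ 2) in
        sq (a :- two :* b) :+ (sq (b :+ two :* a) :+ (sq (c :- two :* d) :+ sq (d :+ two :* c))) :=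
        (sq a :+ (sq b :+ (sq c :+ sq d))) :* con (+ 5)) refl a b c d ⟩
  (a ℤ.* a ℤ.+ (b ℤ.* b ℤ.+ (c ℤ.* c ℤ.+ d ℤ.* d))) ℤ.* + 5
    ≡⟨ cong (ℤ._* + 5) (+norm a b c d) ⟨
  + norm y ℤ.* + 5
    ≡⟨ ℤ.pos-* (norm y) 5 ⟨
  + (norm y * 5) ∎)
  where
  open ≡-Reasoning
  open ℤ-Solver

-- Multiplying by the conjugate 1 - 2i recovers five times each coordinate.
[1+2i]·-injective : ∀ {x y} → [1+2i]· x ≡ [1+2i]· y → x ≡ y
[1+2i]·-injective {a , b , c , d} {a′ , b′ , c′ , d′} eq =
  cong₂ _,_ (left e₀ e₁) (cong₂ _,_ (right e₀ e₁) (cong₂ _,_ (left e₂ e₃) (right e₂ e₃)))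
  where
  open ℤ-Solver
  e₀ = cong proj₁ eq
  e₁ = cong (proj₁ ∘ proj₂) eq
  e₂ = cong (proj₁ ∘ proj₂ ∘ proj₂) eq
  e₃ = cong (proj₂ ∘ proj₂ ∘ proj₂) eq
  left : ∀ {a b a′ b′} → a ℤ.- + 2 ℤ.* b ≡ a′ ℤ.- + 2 ℤ.* b′ → b ℤ.+ + 2 ℤ.* a ≡ b′ ℤ.+ + 2 ℤ.* a′ → a ≡ a′
  left {a} {b} {a′} {b′} p q = ℤ.*-cancelʳ-≡ a a′ (+ 5)
    (trans (lemma a b) (trans (cong₂ (λ u v → u ℤ.+ + 2 ℤ.* v) p q) (sym (lemma a′ b′))))
    where
    lemma : ∀ a b → a ℤ.* + 5 ≡ (a ℤ.- + 2 ℤ.* b) ℤ.+ + 2 ℤ.* (b ℤ.+ + 2 ℤ.* a)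
    lemma = solve 2 (λ a b → a :* con (+ 5) := (a :- con (+ 2) :* b) :+ con (+ 2) :* (b :+ con (+ 2) :* a)) refl
  right : ∀ {a b a′ b′} → a ℤ.- + 2 ℤ.* b ≡ a′ ℤ.- + 2 ℤ.* b′ → b ℤ.+ + 2 ℤ.* a ≡ b′ ℤ.+ + 2 ℤ.* a′ → b ≡ b′
  right {a} {b} {a′} {b′} p q = ℤ.*-cancelʳ-≡ b b′ (+ 5)
    (trans (lemma a b) (trans (cong₂ (λ u v → v ℤ.- + 2 ℤ.* u) p q) (sym (lemma a′ b′))))
    where
    lemma : ∀ a b → b ℤ.* + 5 ≡ (b ℤ.+ + 2 ℤ.* a) ℤ.- + 2 ℤ.* (a ℤ.- + 2 ℤ.* b)
    lemma = solve 2 (λ a b → b :* con (+ 5) := (b :+ con (+ 2) :* a) :- con (+ 2) :* (a :- con (+ 2) :* b)) refl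

-- Membership in the ideal generated by 1 + 2i.
Divisible : ℤ⁴ → Set
Divisible (a , b , c , d) = + 5 ∣ℤ b ℤ.+ + 3 ℤ.* a × + 5 ∣ℤ d ℤ.+ + 3 ℤ.* c

divisible? : ∀ x → Dec (Divisible x)
divisible? (a , b , c , d) = (+ 5 ℤ∣.∣? b ℤ.+ + 3 ℤ.* a) ×-dec (+ 5 ℤ∣.∣? d ℤ.+ + 3 ℤ.* c)

[1+2i]·-divisible : ∀ y → Divisible ([1+2i]· y)
[1+2i]·-divisible (a , b , c , d) = lemma a b , lemma c d
  where
  open ℤ-Solver
  lemma : ∀ a b → + 5 ∣ℤ (b ℤ.+ + 2 ℤ.* a) ℤ.+ + 3 ℤ.* (a ℤ.- + 2 ℤ.* b)
  lemma a b = ℤ∣.divides (a ℤ.- b) (solve 2 (λ a b →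
    (b :+ con (+ 2) :* a) :+ con (+ 3) :* (a :- con (+ 2) :* b) := (a :- b) :* con (+ 5)) refl a b)

divisible⇒[1+2i]· : ∀ x → Divisible x → ∃ λ y → [1+2i]· y ≡ x
divisible⇒[1+2i]· (a , b , c , d) (ℤ∣.divides k eq , ℤ∣.divides l eq′) =
  -- The quotient of a + b i by 1 + 2i is ((a + 2 b) + (b - 2 a) i) / 5; with b = 5 k - 3 a this is
  -- (2 k - a) + (k - a) i. The pair c, d is treated alike.
  (a ℤ.+ + 2 ℤ.* (k ℤ.- a) , k ℤ.- a , c ℤ.+ + 2 ℤ.* (l ℤ.- c) , l ℤ.- c) ,
  cong₂ _,_ (first a k) (cong₂ _,_ (second a b k eq) (cong₂ _,_ (first c l) (second c d l eq′)))
  where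
  open ℤ-Solver
  first : ∀ a k → (a ℤ.+ + 2 ℤ.* (k ℤ.- a)) ℤ.- + 2 ℤ.* (k ℤ.- a) ≡ a
  first = solve 2 (λ a k → (a :+ con (+ 2) :* (k :- a)) :- con (+ 2) :* (k :- a) := a) refl
  second : ∀ a b k → b ℤ.+ + 3 ℤ.* a ≡ k ℤ.* + 5 → (k ℤ.- a) ℤ.+ + 2 ℤ.* (a ℤ.+ + 2 ℤ.* (k ℤ.- a)) ≡ b
  second a b k eq = begin
    (k ℤ.- a) ℤ.+ + 2 ℤ.* (a ℤ.+ + 2 ℤ.* (k ℤ.- a))
      ≡⟨ solve 2 (λ a k → (k :- a) :+ con (+ 2) :* (a :+ con (+ 2) :* (k :- a)) := k :* con (+ 5) :- con (+ 3) :* a) refl a k ⟩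
    k ℤ.* + 5 ℤ.- + 3 ℤ.* a
      ≡⟨ cong (λ t → t ℤ.- + 3 ℤ.* a) eq ⟨
    b ℤ.+ + 3 ℤ.* a ℤ.- + 3 ℤ.* a
      ≡⟨ solve 2 (λ a b → b :+ con (+ 3) :* a :- con (+ 3) :* a := b) refl a b ⟩
    b ∎
    where open ≡-Reasoning

_≈⁴_ : ℤ⁴ → ℤ⁴ → Set
(a , b , c , d) ≈⁴ (a′ , b′ , c′ , d′) =
  a ≡ a′ [mod 5 ] × b ≡ b′ [mod 5 ] × c ≡ c′ [mod 5 ] × d ≡ d′ [mod 5 ]

∣-resp : ∀ {x y} → x ≡ y [mod 5 ] → + 5 ∣ℤ x → + 5 ∣ℤ y
∣-resp {x} {y} x≈y 5∣x = subst (+ 5 ∣ℤ_) (ℤ.+-identityʳ y)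
  (divides-difference (ℤ₅.trans (ℤ₅.sym x≈y) (congruent {x} {0ℤ} (subst (+ 5 ∣ℤ_) (sym (ℤ.+-identityʳ x)) 5∣x))))

divisible-resp : ∀ x y → x ≈⁴ y → Divisible x → Divisible y
divisible-resp x y (a≈ , b≈ , c≈ , d≈) (p , q) =
  ∣-resp (ℤ₅.+-cong b≈ (ℤ₅.*-congˡ {+ 3} a≈)) p , ∣-resp (ℤ₅.+-cong d≈ (ℤ₅.*-congˡ {+ 3} c≈)) q

≈⁴-sym : ∀ x y → x ≈⁴ y → y ≈⁴ x
≈⁴-sym x y (a , b , c , d) = ℤ₅.sym a , ℤ₅.sym b , ℤ₅.sym c , ℤ₅.sym d

record Isometry : Set where
  field
    to from : ℤ⁴ → ℤ⁴
    to∘from : ∀ x → to (from x) ≡ x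
    from∘to : ∀ x → from (to x) ≡ x
    norm-to : ∀ x → norm (to x) ≡ norm x
    to-cong : ∀ x y → x ≈⁴ y → to x ≈⁴ to y
open Isometry

-- Automorphisms of the quaternions: `rotation` permutes i, j, k cyclically, and `reflection` is
-- conjugation by j, which takes 1 + 2i to 1 - 2i.
identity rotation reflection : Isometry
identity = record
  { to = id ; from = id ; to∘from = λ _ → refl ; from∘to = λ _ → refl
  ; norm-to = λ _ → refl ; to-cong = λ _ _ → id }
rotation = record
  { to = λ (a , b , c , d) → a , c , d , b
  ; from = λ (a , b , c , d) → a , d , b , c
  ; to∘from = λ _ → refl
  ; from∘to = λ _ → refl
  ; norm-to = λ (a , b , c , d) → cong (λ s → square a + s)
      (trans (sym (+-assoc (square c) (square d) (square b))) (+-comm (square c + square d) (square b)))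
  ; to-cong = λ _ _ (a , b , c , d) → a , c , d , b
  }
reflection = record
  { to = flip
  ; from = flip
  ; to∘from = flip-involutive
  ; from∘to = flip-involutive
  ; norm-to = λ (a , b , c , d) → cong₂ (λ u v → square a + (u + (square c + v))) (square-neg b) (square-neg d)
  ; to-cong = λ _ _ (a , b , c , d) → a , ℤ₅.-‿cong b , c , ℤ₅.-‿cong d
  }
  where
  flip : ℤ⁴ → ℤ⁴
  flip (a , b , c , d) = a , ℤ.- b , c , ℤ.- d
  flip-involutive : ∀ x → flip (flip x) ≡ x
  flip-involutive (a , b , c , d) = cong₂ (λ u v → a , u , c , v) (ℤ.neg-involutive b) (ℤ.neg-involutive d)
  square-neg : ∀ z → square (ℤ.- z) ≡ square z
  square-neg z = cong₂ _*_ (ℤ.∣-i∣≡∣i∣ z) (ℤ.∣-i∣≡∣i∣ z)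

infixr 9 _∙_
_∙_ : Isometry → Isometry → Isometry
σ ∙ τ = record
  { to = to σ ∘ to τ
  ; from = from τ ∘ from σ
  ; to∘from = λ x → trans (cong (to σ) (to∘from τ (from σ x))) (to∘from σ x)
  ; from∘to = λ x → trans (cong (from τ) (from∘to σ (to τ x))) (from∘to τ x)
  ; norm-to = λ x → trans (norm-to σ (to τ x)) (norm-to τ x)
  ; to-cong = λ x y x≈y → to-cong σ (to τ x) (to τ y) (to-cong τ x y x≈y)
  }

-- These carry the six classes 1 ± 2i, 1 ± 2j, 1 ± 2k of quaternions of norm 5,
-- up to units, to that of 1 + 2i.
isometries : List Isometry
isometries = identity ∷ rotation ∷ rotation ∙ rotation
           ∷ reflection ∷ reflection ∙ rotation ∷ reflection ∙ rotation ∙ rotation ∷ []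

-- Multiplication by 1 + 2i followed by `from σ` multiplies norms by 5, is injective, and reaches
-- exactly the elements that σ carries into the ideal.
fibre-divisible : ∀ (E : Enumeration norm) n σ → length (filter (divisible? ∘ to σ) (fibre E (n * 5))) ≡ length (fibre E n)
fibre-divisible E n σ = trans
  (unique-length (Unique.filter⁺ (divisible? ∘ to σ) (unique E (n * 5)))
     (Unique.map⁺ {f = f} f-injective (unique E n)) sub sup)
  (length-map f (fibre E n))
  where
  f : ℤ⁴ → ℤ⁴
  f = from σ ∘ [1+2i]·
  to-f : ∀ y → to σ (f y) ≡ [1+2i]· y
  to-f y = to∘from σ ([1+2i]· y)
  f-injective : ∀ {x y} → f x ≡ f y → x ≡ y
  f-injective {x} {y} eq = [1+2i]·-injective (trans (sym (to-f x)) (trans (cong (to σ) eq) (to-f y)))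
  norm-f : ∀ y → norm (f y) ≡ norm y * 5
  norm-f y = trans (sym (norm-to σ (f y))) (trans (cong norm (to-f y)) (norm-[1+2i]· y))
  sub : ∀ {x} → x ∈ filter (divisible? ∘ to σ) (fibre E (n * 5)) → x ∈ map f (fibre E n)
  sub {x} x∈ with x∈′ , div ← ∈-filter⁻ (divisible? ∘ to σ) {xs = fibre E (n * 5)} x∈
            with y , eq ← divisible⇒[1+2i]· (to σ x) div =
    subst (_∈ map f (fibre E n)) fy≡x
      (∈-map⁺ f (subst (λ m → y ∈ fibre E m) norm-y (complete E y)))
    where
    fy≡x : f y ≡ x
    fy≡x = trans (cong (from σ) eq) (from∘to σ x)
    norm-y : norm y ≡ n
    norm-y = *-cancelʳ-≡ (norm y) n 5 (trans (sym (norm-f y)) (trans (cong norm fy≡x) (sound E x∈′)))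
  sup : ∀ {x} → x ∈ map f (fibre E n) → x ∈ filter (divisible? ∘ to σ) (fibre E (n * 5))
  sup x∈ with y , y∈ , refl ← ∈-map⁻ f x∈ =
    ∈-filter⁺ (divisible? ∘ to σ)
      (subst (λ m → f y ∈ fibre E m) (trans (norm-f y) (cong (_* 5) (sound E y∈))) (complete E (f y)))
      (subst Divisible (sym (to-f y)) ([1+2i]·-divisible y))

hits : List Isometry → ℤ⁴ → ℕ
hits σs x = length (filter (λ σ → divisible? (to σ x)) σs)

-- Reduces the claim about all quaternions to a check of the 5⁴ residue classes.
hits-cong : ∀ σs x y → x ≈⁴ y → hits σs x ≡ hits σs y
hits-cong []       x y x≈y = refl
hits-cong (σ ∷ σs) x y x≈y with does (divisible? (to σ x)) | does (divisible? (to σ y))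
                 | does-⇔ (mk⇔ (divisible-resp (to σ x) (to σ y) (to-cong σ x y x≈y))
                                (divisible-resp (to σ y) (to σ x) (≈⁴-sym (to σ x) (to σ y) (to-cong σ x y x≈y))))
                           (divisible? (to σ x)) (divisible? (to σ y))
... | true  | .true  | refl = cong suc (hits-cong σs x y x≈y)
... | false | .false | refl = hits-cong σs x y x≈y

-- Multiples of 5 lie in all six ideals, other quaternions of norm divisible by 5 in exactly one.
hits-residues : ∀ (a b c d : Fin 5) → norm (+ toℕ a , + toℕ b , + toℕ c , + toℕ d) % 5 ≡ 0 →
                hits isometries (+ toℕ a , + toℕ b , + toℕ c , + toℕ d) % 5 ≡ 1
hits-residues = from-yes (all? {5} λ a → all? {5} λ b → all? {5} λ c → all? {5} λ d →
  (norm (+ toℕ a , + toℕ b , + toℕ c , + toℕ d) % 5 ≟ 0) →-dec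
  (hits isometries (+ toℕ a , + toℕ b , + toℕ c , + toℕ d) % 5 ≟ 1))

-- Double counting of the pairs related by Q.
filter-swap : ∀ {A B : Set} {Q : A → B → Set} (Q? : ∀ a b → Dec (Q a b)) as bs →
  sum (map (λ a → length (filter (Q? a) bs)) as) ≡ sum (map (λ b → length (filter (λ a → Q? a b) as)) bs)
filter-swap Q? as []       = zeros as
  where
  zeros : ∀ as → sum (map (λ a → 0) as) ≡ 0
  zeros []       = refl
  zeros (_ ∷ as) = zeros as
filter-swap Q? as (b ∷ bs) =
  trans (split as) (cong (λ s → length (filter (λ a → Q? a b) as) + s) (filter-swap Q? as bs))
  where
  split : ∀ as → sum (map (λ a → length (filter (Q? a) (b ∷ bs))) as) ≡
                 length (filter (λ a → Q? a b) as) + sum (map (λ a → length (filter (Q? a) bs)) as)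
  regroup : ∀ a as → length (filter (Q? a) bs) + sum (map (λ a → length (filter (Q? a) (b ∷ bs))) as) ≡
                     length (filter (λ a → Q? a b) as) + sum (map (λ a → length (filter (Q? a) bs)) (a ∷ as))
  regroup a as = trans (cong (λ s → length (filter (Q? a) bs) + s) (split as))
    (x∙yz≈y∙xz (length (filter (Q? a) bs)) (length (filter (λ a → Q? a b) as)) (sum (map (λ a → length (filter (Q? a) bs)) as)))
  split []       = refl
  split (a ∷ as) with does (Q? a b)
  ... | true  = cong suc (regroup a as)
  ... | false = regroup a as

hits%5 : ∀ n x → norm x ≡ n * 5 → hits isometries x % 5 ≡ 1
hits%5 n x@(a , b , c , d) eq = reduce (residue₅ a) (residue₅ b) (residue₅ c) (residue₅ d)
  where
  5∣norm : + 5 ∣ℤ a ℤ.* a ℤ.+ (b ℤ.* b ℤ.+ (c ℤ.* c ℤ.+ d ℤ.* d))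
  5∣norm = ℤ∣.divides (+ n) (trans (sym (+norm a b c d)) (trans (cong +_ eq) (ℤ.pos-* n 5)))

  reduce : (∃ λ (r : Fin 5) → a ≡ + toℕ r [mod 5 ]) → (∃ λ (s : Fin 5) → b ≡ + toℕ s [mod 5 ]) →
           (∃ λ (t : Fin 5) → c ≡ + toℕ t [mod 5 ]) → (∃ λ (u : Fin 5) → d ≡ + toℕ u [mod 5 ]) →
           hits isometries x % 5 ≡ 1
  reduce (r , a≈) (s , b≈) (t , c≈) (u , d≈) =
    trans (cong (_% 5) (hits-cong isometries x y (a≈ , b≈ , c≈ , d≈)))
          (hits-residues r s t u (n∣m⇒m%n≡0 (norm y) 5 (ℤ∣.∣⇒∣ᵤ 5∣norm-y)))
    where
    y : ℤ⁴
    y = + toℕ r , + toℕ s , + toℕ t , + toℕ u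
    5∣norm-y : + 5 ∣ℤ + norm y
    5∣norm-y = subst (+ 5 ∣ℤ_) (sym (+norm (+ toℕ r) (+ toℕ s) (+ toℕ t) (+ toℕ u)))
      (∣-resp (ℤ₅.+-cong (ℤ₅.*-cong a≈ a≈) (ℤ₅.+-cong (ℤ₅.*-cong b≈ b≈) (ℤ₅.+-cong (ℤ₅.*-cong c≈ c≈) (ℤ₅.*-cong d≈ d≈)))) 5∣norm)

sum%5 : {A : Set} (h : A → ℕ) (xs : List A) → (∀ {x} → x ∈ xs → h x % 5 ≡ 1) →
        ∃ λ k → sum (map h xs) ≡ length xs + k * 5
sum%5 h []       h%5 = 0 , refl
sum%5 h (x ∷ xs) h%5 with k , eq ← sum%5 h xs (h%5 ∘ there) = h x / 5 + k , (begin
  h x + sum (map h xs)                               ≡⟨ cong₂ _+_ (m≡m%n+[m/n]*n (h x) 5) eq ⟩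
  h x % 5 + h x / 5 * 5 + (length xs + k * 5)        ≡⟨ cong (λ r → r + h x / 5 * 5 + (length xs + k * 5)) (h%5 (here refl)) ⟩
  suc (h x / 5 * 5 + (length xs + k * 5))            ≡⟨ cong suc (solve 3 (λ j l k → j :* con 5 :+ (l :+ k :* con 5) := l :+ (j :+ k) :* con 5)
                                                                      refl (h x / 5) (length xs) k) ⟩
  suc (length xs + (h x / 5 + k) * 5)                ∎)
  where
  open ≡-Reasoning
  open ℕ-Solver

-- Incidences between ideals and elements of norm 5 n, counted ideal by ideal.
sum-hits : ∀ (E : Enumeration norm) σs n →
           sum (map (hits σs) (fibre E (n * 5))) ≡ length σs * length (fibre E n)
sum-hits E σs n = trans (sym (filter-swap (λ σ x → divisible? (to σ x)) σs (fibre E (n * 5)))) (each σs)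
  where
  each : ∀ σs → sum (map (λ σ → length (filter (λ x → divisible? (to σ x)) (fibre E (n * 5)))) σs) ≡ length σs * length (fibre E n)
  each []       = refl
  each (σ ∷ σs) = cong₂ _+_ (fibre-divisible E n σ) (each σs)

-- Counted by elements, the incidences number r₄(5 n) modulo 5, each element contributing 1 modulo
-- 5; counted by ideals, they number 6 r₄(n), which is r₄(n) modulo 5.
r₄[5n]≡r₄[n] : ∀ (E : Enumeration norm) n → count E (n * 5) ≡ count E n [mod 5 ]
r₄[5n]≡r₄[n] E n = conclude
  (sum%5 (hits isometries) (fibre E (n * 5)) (λ {x} x∈ → hits%5 n x (sound E x∈)))
  (sum-hits E isometries n)
  where
  conclude : ∀ {r r′ s} → (∃ λ k → s ≡ r′ + k * 5) → s ≡ 6 * r → + r′ ≡ + r [mod 5 ]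
  conclude {r} {r′} (k , s≡) s≡′ = congruent (ℤ∣.divides (+ r ℤ.- + k) (begin
    + r′ ℤ.- + r
      ≡⟨ solve 3 (λ r′ k r → r′ :- r := (r′ :+ k :* con (+ 5)) :- (r :+ k :* con (+ 5))) refl (+ r′) (+ k) (+ r) ⟩
    (+ r′ ℤ.+ + k ℤ.* + 5) ℤ.- (+ r ℤ.+ + k ℤ.* + 5)
      ≡⟨ cong (λ t → (+ r′ ℤ.+ t) ℤ.- (+ r ℤ.+ + k ℤ.* + 5)) (ℤ.pos-* k 5) ⟨
    + (r′ + k * 5) ℤ.- (+ r ℤ.+ + k ℤ.* + 5)
      ≡⟨ cong (λ t → + t ℤ.- (+ r ℤ.+ + k ℤ.* + 5)) (trans (sym s≡) s≡′) ⟩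
    + (6 * r) ℤ.- (+ r ℤ.+ + k ℤ.* + 5)
      ≡⟨ cong (λ t → t ℤ.- (+ r ℤ.+ + k ℤ.* + 5)) (ℤ.pos-* 6 r) ⟩
    + 6 ℤ.* + r ℤ.- (+ r ℤ.+ + k ℤ.* + 5)
      ≡⟨ solve 2 (λ r k → con (+ 6) :* r :- (r :+ k :* con (+ 5)) := (r :- k) :* con (+ 5)) refl (+ r) (+ k) ⟩
    (+ r ℤ.- + k) ℤ.* + 5 ∎))
    where
    open ≡-Reasoning
    open ℤ-Solver

-- Divisibility by 5

private
  module S₅ = CommutativeRing (PowerSeries.series ℤ₅)

-- Both products perform the same integer operations but belong to series over different rings, so
-- identifying them takes an induction.
⊛₅≡⊛ : ∀ f {g h} → g ≋ h → ∀ n → (f S₅.* g) n ≡ (f ⊛ h) n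
⊛₅≡⊛ f g≋h zero    = cong (f 0 ℤ.*_) (g≋h 0)
⊛₅≡⊛ f g≋h (suc n) = cong₂ (λ a b → f 0 ℤ.* a ℤ.+ b) (g≋h (suc n)) (⊛₅≡⊛ (f ∘ suc) g≋h n)

φ³₅≡φ³ : ∀ n → (φ S₅.* (φ S₅.* φ)) n ≡ (φ ⊛ (φ ⊛ φ)) n
φ³₅≡φ³ = ⊛₅≡⊛ φ (⊛₅≡⊛ φ λ _ → refl)

-- Extracting every fifth coefficient of A φ(q⁵) = φ⁴ turns it into U(A) φ = U(φ⁴) = φ⁴.
A[5n]≡φ³ : (λ n → A (n * 5)) S₅.≈ φ S₅.* (φ S₅.* φ)
A[5n]≡φ³ = begin
  UA                                 ≈⟨ S₅.*-identityˡ UA ⟨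
  -- Inserting 1 = A φ here and removing it at the end takes the place of dividing by φ.
  S₅.1# S₅.* UA                      ≈⟨ S₅.*-congʳ {UA} Aφ≈1 ⟨
  A S₅.* φ S₅.* UA                   ≈⟨ S₅.*-assoc A φ UA ⟩
  A S₅.* (φ S₅.* UA)                 ≈⟨ S₅.*-congˡ {A} (λ n → ℤ₅.sym (section-dilate φ A n)) ⟩
  A S₅.* (λ n → (φ[q⁵] S₅.* A) (n * 5))
                                     ≈⟨ S₅.*-congˡ {A} (λ n → φ[q⁵]A≈φ⁴ (n * 5)) ⟩
  A S₅.* (λ n → φ⁴ (n * 5))          ≈⟨ S₅.*-congˡ {A} φ⁴[5n] ⟩
  A S₅.* (φ S₅.* φ³)                 ≈⟨ S₅.*-assoc A φ φ³ ⟨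
  A S₅.* φ S₅.* φ³                   ≈⟨ S₅.*-congʳ {φ³} Aφ≈1 ⟩
  S₅.1# S₅.* φ³                      ≈⟨ S₅.*-identityˡ φ³ ⟩
  φ³                                 ∎
  where
  open SetoidReasoning S₅.setoid
  open SemiringSolver S₅.commutativeSemiring using (solve; _:*_; _:=_)
  UA φ³ φ⁴ φ[q⁵] : ℕ → ℤ
  UA n = A (n * 5)
  φ³ = φ S₅.* (φ S₅.* φ)
  φ⁴ = φ S₅.* φ³
  φ[q⁵] = dilate φ
  Aφ≈1 : A S₅.* φ S₅.≈ S₅.1#
  Aφ≈1 n = ℤ₅.reflexive (trans (⊛₅≡⊛ A (λ _ → refl) n) (trans (A⊛φ≋1 n) (one≡ n)))
    where
    one≡ : ∀ n → one n ≡ S₅.1# n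
    one≡ zero    = refl
    one≡ (suc _) = refl
  φ[q⁵]A≈φ⁴ : φ[q⁵] S₅.* A S₅.≈ φ⁴
  φ[q⁵]A≈φ⁴ = begin
    φ[q⁵] S₅.* A                                  ≈⟨ S₅.*-congʳ {A} (frobenius ℤ₅-char ℤ₅-fermat φ) ⟨
    φ S₅.* φ S₅.* φ S₅.* φ S₅.* φ S₅.* A          ≈⟨ solve 2 (λ f a → f :* f :* f :* f :* f :* a := (a :* f) :* (f :* (f :* (f :* f))))
                                                     S₅.refl φ A ⟩
    A S₅.* φ S₅.* φ⁴                              ≈⟨ S₅.*-congʳ {φ⁴} Aφ≈1 ⟩
    S₅.1# S₅.* φ⁴                                 ≈⟨ S₅.*-identityˡ φ⁴ ⟩
    φ⁴                                            ∎
  quadruples : Enumeration norm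
  quadruples = squares ⊗ squares ⊗ squares ⊗ squares
  count≡φ⁴ : ∀ n → count quadruples n ≡ φ⁴ n
  count≡φ⁴ n = trans (count-⊗ squares (squares ⊗ squares ⊗ squares) n)
    (sym (⊛₅≡⊛ φ (λ n → trans (φ³₅≡φ³ n) (sym (count-φ³ n))) n))
  φ⁴[5n] : (λ n → φ⁴ (n * 5)) S₅.≈ φ⁴
  φ⁴[5n] n = subst₂ (_≡_[mod 5 ]) (count≡φ⁴ (n * 5)) (count≡φ⁴ n) (r₄[5n]≡r₄[n] quadruples n)

5∣p̄ : ∀ α k → 5 ∣ p̄ (4 ^ α * (8 * k + 7) * 5)
5∣p̄ α k = subst (5 ∣_) (∣A∣≡p̄ (n * 5)) (ℤ∣.∣⇒∣ᵤ (∣-resp (ℤ₅.sym A≈0) (ℤ∣.divides 0ℤ refl)))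
  where
  n = 4 ^ α * (8 * k + 7)
  A≈0 : A (n * 5) ≡ 0ℤ [mod 5 ]
  A≈0 = subst (λ z → A (n * 5) ≡ z [mod 5 ]) (trans (φ³₅≡φ³ n) (φ³-zero α k)) (A[5n]≡φ³ n)

-- Divisibility by 40

40∣p̄ : ∀ n α → 40 ∣ p̄ (4 ^ α * (40 * n + 35))
-- Both cases apply because 40 n + 35 = 8 (5 n + 4) + 3 = 5 (8 n + 7).
40∣p̄ n α = lcm-least {8} {5}
  (subst (λ m → 8 ∣ p̄ (4 ^ α * m)) (solve 1 (λ n → con 8 :* (con 5 :* n :+ con 4) :+ con 3 := con 40 :* n :+ con 35) refl n)
         (8∣p̄ α (5 * n + 4)))
  (subst (λ m → 5 ∣ p̄ m) (solve 2 (λ p n → p :* (con 8 :* n :+ con 7) :* con 5 := p :* (con 40 :* n :+ con 35)) refl (4 ^ α) n)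
         (5∣p̄ α n))
  where open ℕ-Solver

theorem2 : ((n α : ℕ) → 40 ∣ p̄ (4 ^ α * (40 * n + 35))) × ((n : ℕ) → 40 ∣ p̄ (40 * n + 35))
theorem2 = 40∣p̄ , λ n → subst (λ m → 40 ∣ p̄ m) (*-identityˡ (40 * n + 35)) (40∣p̄ n 0)
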